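{- For every integer $n\ge 3$, \[ \overline{\mathrm{lcr}}(K_n) \le \begin{cases} \frac{1}{9}(n-3)^2 & \text{if } n \equiv 0 \pmod 3,\\ \frac{1}{9}(n-1)(n-4) & \text{if } n \equiv 1 \pmod 3,\\ \frac{1}{9}(n-2)^2 & \text{if } n \equiv 2 \pmod 3.\end{cases} \]
   Context: A rectilinear drawing of the complete graph $K_n$ consists of $n$ points in the plane in general position (no three collinear), the vertices, with every pair of vertices joined by the straight line segment between them, the edges. Two edges cross if their segments intersect at a point that is not a common endpoint. The local crossing number of a drawing is the largest number of edges crossing any single edge of the drawing. The rectilinear local crossing number $\overline{\mathrm{lcr}}(K_n)$ is the minimum of the local crossing number over all rectilinear drawings of $K_n$. -}

module Defs where

open import Data.Nat as ℕ using (ℕ; zero; suc; _∸_)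
open import Data.Nat.DivMod using (_%_)
open import Data.Fin as Fin using (Fin)
open import Data.Rational as ℚ using (ℚ; 0ℚ; 1ℚ)
open import Data.Product using (Σ; ∃; _×_; _,_; proj₁; proj₂)
open import Data.Sum using (_⊎_)
open import Data.List using (List; length)
open import Data.List.Relation.Unary.All using (All)
open import Data.List.Relation.Unary.Unique.Propositional using (Unique)
open import Relation.Binary.PropositionalEquality using (_≡_; _≢_)
open import Relation.Nullary using (¬_)

-- A point of the plane (rational coordinates; see NOTES.md FIDELITY).
Point : Set
Point = ℚ × ℚ

-- Three points are collinear iff the orientation determinant vanishes.
Collinear : Point → Point → Point → Set
Collinear (ax , ay) (bx , by) (cx , cy) =
  (bx ℚ.- ax) ℚ.* (cy ℚ.- ay) ℚ.- (by ℚ.- ay) ℚ.* (cx ℚ.- ax) ≡ 0ℚ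

-- n distinct points, no three collinear.
GeneralPosition : {n : ℕ} → (Fin n → Point) → Set
GeneralPosition {n} p =
  (∀ i j → p i ≡ p j → i ≡ j) ×
  (∀ i j k → i ≢ j → j ≢ k → i ≢ k → ¬ Collinear (p i) (p j) (p k))

-- q lies on the closed straight-line segment from a to b.
OnSegment : Point → Point → Point → Set
OnSegment (ax , ay) (bx , by) (qx , qy) =
  Σ ℚ λ s → (0ℚ ℚ.≤ s) × (s ℚ.≤ 1ℚ) ×
    (qx ≡ ax ℚ.+ s ℚ.* (bx ℚ.- ax)) × (qy ≡ ay ℚ.+ s ℚ.* (by ℚ.- ay))

-- An edge of K_n is a pair (i , j) with i < j (each unordered pair once).
Edge : {n : ℕ} → Fin n × Fin n → Set
Edge (i , j) = i Fin.< j

-- Two distinct edges cross: their segments meet at a point that is not a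
-- common endpoint.
Crosses : {n : ℕ} → (Fin n → Point) → Fin n × Fin n → Fin n × Fin n → Set
Crosses {n} p (i , j) (k , l) =
  ((i , j) ≢ (k , l)) ×
  Σ Point λ q → OnSegment (p i) (p j) q × OnSegment (p k) (p l) q ×
    ¬ (Σ (Fin n) λ v → (v ≡ i ⊎ v ≡ j) × (v ≡ k ⊎ v ≡ l) × q ≡ p v)

-- The drawing p has local crossing number at most the given bound b,
-- expressed as: every edge is crossed by at most b edges, where "at most b"
-- means every duplicate-free list of edges crossing e has length ≤ b.
-- Here the bound is given as 9 * (number) ≤ numerator.
LcrTimes9AtMost : {n : ℕ} → (Fin n → Point) → ℕ → Set
LcrTimes9AtMost {n} p m =
  ∀ (e : Fin n × Fin n) → Edge e →
  ∀ (es : List (Fin n × Fin n)) → Unique es →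
  All (λ f → Edge f × Crosses p e f) es →
  9 ℕ.* length es ℕ.≤ m

-- Numerator of the bound: (n-3)^2, (n-1)(n-4), (n-2)^2 by n mod 3.
boundNumer : ℕ → ℕ
boundNumer n with n % 3
... | 0 = (n ∸ 3) ℕ.* (n ∸ 3)
... | 1 = (n ∸ 1) ℕ.* (n ∸ 4)
... | _ = (n ∸ 2) ℕ.* (n ∸ 2)

{-# OPTIONS --safe #-}
-- Place n = a + b + c points on the cuspidal cubic y² = x³, as (t², t³) for integer parameters t:
-- a points of class A with t in [-3n, -2n), b of class B with t in [1, n) and c of class C with t in
-- [2n, 3n), where c ≤ b ≤ a ≤ c + 1.  The orientation of the points with parameters x, y, z is
-- (y - x)(z - x)(z - y)(xy + xz + yz), and on these ranges the sign of xy + xz + yz only depends on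
-- the classes of the three points.  Hence whether two edges cross is decided by the relative order
-- and the classes of their endpoints, and checking all such patterns shows that the edges xy crossing
-- a fixed edge uv have (x, y) in a few boxes [x₀, x₁) × [y₀, y₁) with sides among 0, a, a + b, n,
-- u, u + 1, v, v + 1, of total area at most (a - 1)(b - 1).  For n = 3m, 3m + 1, 3m + 2 the split
-- (a, b, c) = (m, m, m), (m + 1, m, m), (m + 1, m + 1, m) makes 9(a - 1)(b - 1) the claimed bound.
module Submission where

open import Defs
open import Data.Nat using (ℕ; _≤_)
open import Data.Fin using (Fin)
open import Data.Product using (Σ; _×_)

open import Data.Nat using (zero; suc; z≤n; s≤s)

open import Data.Product using (∃; _,_; proj₁; proj₂)
open import Data.Sum using (_⊎_; inj₁; inj₂)
open import Data.Empty using (⊥-elim)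
open import Relation.Nullary using (¬_; yes; no)
open import Relation.Binary.PropositionalEquality
  using (_≡_; _≢_; refl; sym; trans; cong; cong₂; subst; subst₂; ≢-sym; module ≡-Reasoning)
open import Function using (_∘_)
open import Relation.Binary.Definitions using (tri<; tri≈; tri>)

module Orientation where
  open import Data.Rational as ℚ using (ℚ; 0ℚ; 1ℚ; _+_; _-_; _*_; -_; _<_; 1/_)
  import Data.Rational.Properties as ℚₚ
  open import Data.Rational.Solver using (module +-*-Solver)
  open +-*-Solver

  orientation : Point → Point → Point → ℚ
  orientation (ax , ay) (bx , by) (cx , cy) = (bx - ax) * (cy - ay) - (by - ay) * (cx - ax)

  SameSign : ℚ → ℚ → Set
  SameSign x y = (0ℚ < x × 0ℚ < y) ⊎ (x < 0ℚ × y < 0ℚ)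

  -- X and Y do not lie strictly on the same side of the line PQ.
  Separates : Point → Point → Point → Point → Set
  Separates P Q X Y = ¬ SameSign (orientation P Q X) (orientation P Q Y)

  collinear-endpointˡ : ∀ P Q → Collinear P Q P
  collinear-endpointˡ (px , py) (qx , qy) =
    solve 4 (λ px py qx qy → (qx :- px) :* (py :- py) :- (qy :- py) :* (px :- px) := con 0ℚ)
      refl px py qx qy

  collinear-endpointʳ : ∀ P Q → Collinear P Q Q
  collinear-endpointʳ (px , py) (qx , qy) =
    solve 4 (λ px py qx qy → (qx :- px) :* (qy :- py) :- (qy :- py) :* (qx :- px) := con 0ℚ)
      refl px py qx qy

  collinear-repeated : ∀ P R → Collinear P P R
  collinear-repeated (px , py) (rx , ry) =
    solve 4 (λ px py rx ry → (px :- px) :* (ry :- py) :- (py :- py) :* (rx :- px) := con 0ℚ)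
      refl px py rx ry

  orientation-interpolate : ∀ P Q X Y R (R∈XY : OnSegment X Y R) → let s = proj₁ R∈XY in
    orientation P Q R ≡ (1ℚ - s) * orientation P Q X + s * orientation P Q Y
  orientation-interpolate (px , py) (qx , qy) (xx , xy) (yx , yy) _ (s , _ , _ , refl , refl) =
    solve 9 (λ px py qx qy xx xy yx yy s →
        (qx :- px) :* ((xy :+ s :* (yy :- xy)) :- py) :- (qy :- py) :* ((xx :+ s :* (yx :- xx)) :- px)
      := (con 1ℚ :- s) :* ((qx :- px) :* (xy :- py) :- (qy :- py) :* (xx :- px))
         :+ s :* ((qx :- px) :* (yy :- py) :- (qy :- py) :* (yx :- px)))
      refl px py qx qy xx xy yx yy s

  endpoint-collinear : ∀ {P Q V} → V ≡ P ⊎ V ≡ Q → Collinear P Q V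
  endpoint-collinear {P} {Q} (inj₁ refl) = collinear-endpointˡ P Q
  endpoint-collinear {P} {Q} (inj₂ refl) = collinear-endpointʳ P Q

  onSegment⇒collinear : ∀ P Q R → OnSegment P Q R → Collinear P Q R
  onSegment⇒collinear P Q R R∈PQ@(s , _) = begin
    orientation P Q R                                     ≡⟨ orientation-interpolate P Q P Q R R∈PQ ⟩
    (1ℚ - s) * orientation P Q P + s * orientation P Q Q  ≡⟨ cong₂ (λ o o′ → (1ℚ - s) * o + s * o′)
                                                                   (collinear-endpointˡ P Q) (collinear-endpointʳ P Q) ⟩
    (1ℚ - s) * 0ℚ + s * 0ℚ                                ≡⟨ cong₂ _+_ (ℚₚ.*-zeroʳ (1ℚ - s)) (ℚₚ.*-zeroʳ s) ⟩
    0ℚ                                                    ∎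
    where open ≡-Reasoning

  convex-combination-pos : ∀ {s x y} → 0ℚ ℚ.≤ s → s ℚ.≤ 1ℚ → 0ℚ < x → 0ℚ < y →
    0ℚ < (1ℚ - s) * x + s * y
  convex-combination-pos {s} {x} {y} 0≤s s≤1 0<x 0<y with ℚₚ.<-cmp 0ℚ s
  ... | tri< 0<s _ _ = ℚₚ.+-mono-≤-< 0≤[1-s]x 0<sy
    where
    0≤1-s : 0ℚ ℚ.≤ 1ℚ - s
    0≤1-s = ℚₚ.≤-trans (ℚₚ.≤-reflexive (sym (ℚₚ.+-inverseʳ s))) (ℚₚ.+-monoˡ-≤ (- s) s≤1)
    0≤[1-s]x : 0ℚ ℚ.≤ (1ℚ - s) * x
    0≤[1-s]x = ℚₚ.nonNegative⁻¹ _
      {{ℚₚ.nonNeg*nonNeg⇒nonNeg (1ℚ - s) {{ℚ.nonNegative 0≤1-s}} x {{ℚ.nonNegative (ℚₚ.<⇒≤ 0<x)}}}}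
    0<sy : 0ℚ < s * y
    0<sy = ℚₚ.positive⁻¹ _ {{ℚₚ.pos*pos⇒pos s {{ℚ.positive 0<s}} y {{ℚ.positive 0<y}}}}
  ... | tri≈ _ refl _ =
    subst (0ℚ <_) (solve 2 (λ x y → x := (con 1ℚ :- con 0ℚ) :* x :+ con 0ℚ :* y) refl x y) 0<x
  ... | tri> _ _ s<0 = ⊥-elim (ℚₚ.<-irrefl refl (ℚₚ.<-≤-trans s<0 0≤s))

  convex-combination≢0 : ∀ {s x y} → 0ℚ ℚ.≤ s → s ℚ.≤ 1ℚ → SameSign x y → (1ℚ - s) * x + s * y ≢ 0ℚ
  convex-combination≢0 0≤s s≤1 (inj₁ (0<x , 0<y)) eq = ℚₚ.<⇒≢ (convex-combination-pos 0≤s s≤1 0<x 0<y) (sym eq)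
  convex-combination≢0 {s} {x} {y} 0≤s s≤1 (inj₂ (x<0 , y<0)) eq =
    convex-combination≢0 0≤s s≤1 (inj₁ (ℚₚ.neg-antimono-< x<0 , ℚₚ.neg-antimono-< y<0)) negated
    where
    negated : (1ℚ - s) * (- x) + s * (- y) ≡ 0ℚ
    negated = trans
      (solve 3 (λ s x y → (con 1ℚ :- s) :* (:- x) :+ s :* (:- y) := :- ((con 1ℚ :- s) :* x :+ s :* y)) refl s x y)
      (cong -_ eq)

  segments-meet⇒separates : ∀ P Q X Y R → OnSegment P Q R → OnSegment X Y R → Separates P Q X Y
  segments-meet⇒separates P Q X Y R R∈PQ R∈XY@(_ , 0≤s , s≤1 , _) sameSign =
    convex-combination≢0 0≤s s≤1 sameSign
      (trans (sym (orientation-interpolate P Q X Y R R∈XY)) (onSegment⇒collinear P Q R R∈PQ))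

  onSegment-start : ∀ X Y R (R∈XY : OnSegment X Y R) → proj₁ R∈XY ≡ 0ℚ → R ≡ X
  onSegment-start (xx , xy) (yx , yy) _ (_ , _ , _ , refl , refl) refl =
    cong₂ _,_ (solve 2 (λ x y → x :+ con 0ℚ :* (y :- x) := x) refl xx yx)
              (solve 2 (λ x y → x :+ con 0ℚ :* (y :- x) := x) refl xy yy)

  onSegment-end : ∀ X Y R (R∈XY : OnSegment X Y R) → proj₁ R∈XY ≡ 1ℚ → R ≡ Y
  onSegment-end (xx , xy) (yx , yy) _ (_ , _ , _ , refl , refl) refl =
    cong₂ _,_ (solve 2 (λ x y → x :+ con 1ℚ :* (y :- x) := y) refl xx yx)
              (solve 2 (λ x y → x :+ con 1ℚ :* (y :- x) := y) refl xy yy)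

  p*q≡0⇒p≡0 : ∀ p q → q ≢ 0ℚ → p * q ≡ 0ℚ → p ≡ 0ℚ
  p*q≡0⇒p≡0 p q q≢0 pq≡0 = begin
    p              ≡⟨ sym (ℚₚ.*-identityʳ p) ⟩
    p * 1ℚ         ≡⟨ cong (p *_) (sym (ℚₚ.*-inverseʳ q)) ⟩
    p * (q * 1/ q) ≡⟨ sym (ℚₚ.*-assoc p q (1/ q)) ⟩
    p * q * 1/ q   ≡⟨ cong (_* 1/ q) pq≡0 ⟩
    0ℚ * 1/ q      ≡⟨ ℚₚ.*-zeroˡ (1/ q) ⟩
    0ℚ             ∎
    where
    open ≡-Reasoning
    instance _ = ℚ.≢-nonZero q≢0

  meet-at-common-endpointˡ : ∀ P Q V Y R → V ≡ P ⊎ V ≡ Q → OnSegment P Q R →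
    (R∈VY : OnSegment V Y R) → ¬ Collinear P Q Y → R ≡ V
  meet-at-common-endpointˡ P Q V Y R V∈PQ R∈PQ R∈VY@(s , _) Y∉PQ =
    onSegment-start V Y R R∈VY (p*q≡0⇒p≡0 s (orientation P Q Y) Y∉PQ s*y≡0)
    where
    open ≡-Reasoning
    y = orientation P Q Y
    s*y≡0 : s * y ≡ 0ℚ
    s*y≡0 = begin
      s * y
        ≡⟨ solve 2 (λ s y → s :* y := (con 1ℚ :- s) :* con 0ℚ :+ s :* y) refl s y ⟩
      (1ℚ - s) * 0ℚ + s * y
        ≡⟨ cong (λ o → (1ℚ - s) * o + s * y) (sym (endpoint-collinear V∈PQ)) ⟩
      (1ℚ - s) * orientation P Q V + s * y
        ≡⟨ sym (orientation-interpolate P Q V Y R R∈VY) ⟩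
      orientation P Q R
        ≡⟨ onSegment⇒collinear P Q R R∈PQ ⟩
      0ℚ ∎

  meet-at-common-endpointʳ : ∀ P Q X V R → V ≡ P ⊎ V ≡ Q → OnSegment P Q R →
    (R∈XV : OnSegment X V R) → ¬ Collinear P Q X → R ≡ V
  meet-at-common-endpointʳ P Q X V R V∈PQ R∈PQ R∈XV@(s , _) X∉PQ =
    onSegment-end X V R R∈XV (1-s≡0⇒s≡1 (p*q≡0⇒p≡0 (1ℚ - s) x X∉PQ [1-s]*x≡0))
    where
    open ≡-Reasoning
    x = orientation P Q X
    1-s≡0⇒s≡1 : 1ℚ - s ≡ 0ℚ → s ≡ 1ℚ
    1-s≡0⇒s≡1 eq = trans (solve 1 (λ s → s := con 1ℚ :- (con 1ℚ :- s)) refl s) (cong (λ z → 1ℚ - z) eq)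
    [1-s]*x≡0 : (1ℚ - s) * x ≡ 0ℚ
    [1-s]*x≡0 = begin
      (1ℚ - s) * x
        ≡⟨ solve 2 (λ s x → (con 1ℚ :- s) :* x := (con 1ℚ :- s) :* x :+ s :* con 0ℚ) refl s x ⟩
      (1ℚ - s) * x + s * 0ℚ
        ≡⟨ cong (λ o → (1ℚ - s) * x + s * o) (sym (endpoint-collinear V∈PQ)) ⟩
      (1ℚ - s) * x + s * orientation P Q V
        ≡⟨ sym (orientation-interpolate P Q X V R R∈XV) ⟩
      orientation P Q R
        ≡⟨ onSegment⇒collinear P Q R R∈PQ ⟩
      0ℚ ∎

open Orientation

module GeneralPositionDrawings where
  import Data.Fin as Fin
  import Data.Fin.Properties as Finₚ

  crossing⇒separates : ∀ {n} {p : Fin n → Point} {i j k l} → GeneralPosition p →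
    i Fin.< j → k Fin.< l → Crosses p (i , j) (k , l) →
    (i ≢ k × i ≢ l × j ≢ k × j ≢ l) ×
    Separates (p i) (p j) (p k) (p l) × Separates (p k) (p l) (p i) (p j)
  crossing⇒separates {p = p} {i} {j} {k} {l} (_ , noncollinear) i<j k<l
                     (ij≢kl , R , R∈ij , R∈kl , R∉ends)
    with i Finₚ.≟ k | i Finₚ.≟ l | j Finₚ.≟ k | j Finₚ.≟ l
  ... | yes refl | _ | _ | yes refl = ⊥-elim (ij≢kl refl)
  ... | yes refl | _ | _ | no j≢l = ⊥-elim (R∉ends (i , inj₁ refl , inj₁ refl ,
        meet-at-common-endpointˡ (p i) (p j) (p i) (p l) R (inj₁ refl) R∈ij R∈kl
          (noncollinear i j l (Finₚ.<⇒≢ i<j) j≢l (Finₚ.<⇒≢ k<l))))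
  ... | no _ | yes refl | _ | _ = ⊥-elim (R∉ends (i , inj₁ refl , inj₂ refl ,
        meet-at-common-endpointʳ (p i) (p j) (p k) (p i) R (inj₁ refl) R∈ij R∈kl
          (noncollinear i j k (Finₚ.<⇒≢ i<j) (≢-sym (Finₚ.<⇒≢ (Finₚ.<-trans k<l i<j)))
                         (≢-sym (Finₚ.<⇒≢ k<l)))))
  ... | no _ | no _ | yes refl | _ = ⊥-elim (R∉ends (j , inj₂ refl , inj₁ refl ,
        meet-at-common-endpointˡ (p i) (p j) (p j) (p l) R (inj₂ refl) R∈ij R∈kl
          (noncollinear i j l (Finₚ.<⇒≢ i<j) (Finₚ.<⇒≢ k<l) (Finₚ.<⇒≢ (Finₚ.<-trans i<j k<l)))))
  ... | no i≢k | no _ | no _ | yes refl = ⊥-elim (R∉ends (j , inj₂ refl , inj₂ refl ,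
        meet-at-common-endpointʳ (p i) (p j) (p k) (p j) R (inj₂ refl) R∈ij R∈kl
          (noncollinear i j k (Finₚ.<⇒≢ i<j) (≢-sym (Finₚ.<⇒≢ k<l)) i≢k)))
  ... | no i≢k | no i≢l | no j≢k | no j≢l =
        (i≢k , i≢l , j≢k , j≢l) ,
        segments-meet⇒separates (p i) (p j) (p k) (p l) R R∈ij R∈kl ,
        segments-meet⇒separates (p k) (p l) (p i) (p j) R R∈kl R∈ij

  another-index : ∀ {m} (i j : Fin (suc (suc (suc m)))) → ∃ λ k → k ≢ i × k ≢ j
  another-index i j with Fin.zero Finₚ.≟ i | Fin.zero Finₚ.≟ j
  ... | no 0≢i   | no 0≢j = Fin.zero , 0≢i , 0≢j
  ... | yes refl | _ with Fin.suc Fin.zero Finₚ.≟ j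
  ...   | no 1≢j   = Fin.suc Fin.zero , (λ ()) , 1≢j
  ...   | yes refl = Fin.suc (Fin.suc Fin.zero) , (λ ()) , (λ ())
  another-index i j | no _ | yes refl with Fin.suc Fin.zero Finₚ.≟ i
  ...   | no 1≢i   = Fin.suc Fin.zero , 1≢i , (λ ())
  ...   | yes refl = Fin.suc (Fin.suc Fin.zero) , (λ ()) , (λ ())

  noncollinear⇒injective : ∀ {n} {p : Fin n → Point} → 3 ≤ n →
    (∀ i j k → i ≢ j → j ≢ k → i ≢ k → ¬ Collinear (p i) (p j) (p k)) → ∀ i j → p i ≡ p j → i ≡ j
  noncollinear⇒injective {p = p} (s≤s (s≤s (s≤s _))) noncollinear i j pi≡pj with i Finₚ.≟ j
  ... | yes i≡j = i≡j
  ... | no i≢j with another-index i j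
  ...   | k , k≢i , k≢j = ⊥-elim (noncollinear i j k i≢j (≢-sym k≢j) (≢-sym k≢i)
          (subst (λ P → Collinear P (p j) (p k)) (sym pi≡pj) (collinear-repeated (p j) (p k))))

open GeneralPositionDrawings

module CubicCurve where
  open import Data.Integer as ℤ using (ℤ; +_; +[1+_]; -[1+_]; _◃_; _+_; _-_; _*_; -_; _<_)
  import Data.Integer.Properties as ℤₚ
  open import Data.Integer.Tactic.RingSolver using (solve-∀)
  open import Data.Rational as ℚ using (ℚ; 0ℚ)
  import Data.Rational.Properties as ℚₚ
  open import Data.Rational.Literals using (fromℤ)
  import Data.Rational.Unnormalised as ℚᵘ
  import Data.Rational.Unnormalised.Properties as ℚᵘₚ
  open import Data.Sign as Sign using (Sign)

  fromℤ-+ : ∀ x y → fromℤ (x + y) ≡ fromℤ x ℚ.+ fromℤ y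
  fromℤ-+ x y = ℚₚ.toℚᵘ-injective
    (ℚᵘₚ.≃-trans (ℚᵘ.*≡* (denominators x y)) (ℚᵘₚ.≃-sym (ℚₚ.toℚᵘ-homo-+ (fromℤ x) (fromℤ y))))
    where
    denominators : ∀ x y → (x + y) * + 1 ≡ (x * + 1 + y * + 1) * + 1
    denominators = solve-∀

  fromℤ-* : ∀ x y → fromℤ (x * y) ≡ fromℤ x ℚ.* fromℤ y
  fromℤ-* x y = ℚₚ.toℚᵘ-injective
    (ℚᵘₚ.≃-trans (ℚᵘ.*≡* refl) (ℚᵘₚ.≃-sym (ℚₚ.toℚᵘ-homo-* (fromℤ x) (fromℤ y))))

  fromℤ-neg : ∀ x → fromℤ (- x) ≡ ℚ.- fromℤ x
  fromℤ-neg x = ℚₚ.toℚᵘ-injective (ℚᵘₚ.≃-sym (ℚₚ.toℚᵘ-homo‿- (fromℤ x)))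

  fromℤ-- : ∀ x y → fromℤ (x - y) ≡ fromℤ x ℚ.- fromℤ y
  fromℤ-- x y = trans (fromℤ-+ x (- y)) (cong (fromℤ x ℚ.+_) (fromℤ-neg y))

  cubicPoint : ℤ → Point
  cubicPoint t = fromℤ (t * t) , fromℤ (t * t * t)

  σ₂ : ℤ → ℤ → ℤ → ℤ
  σ₂ x y z = x * y + x * z + y * z

  orientation-fromℤ : ∀ ax ay bx by cx cy →
    orientation (fromℤ ax , fromℤ ay) (fromℤ bx , fromℤ by) (fromℤ cx , fromℤ cy)
      ≡ fromℤ ((bx - ax) * (cy - ay) - (by - ay) * (cx - ax))
  orientation-fromℤ ax ay bx by cx cy = sym (begin
    fromℤ ((bx - ax) * (cy - ay) - (by - ay) * (cx - ax))
      ≡⟨ fromℤ-- ((bx - ax) * (cy - ay)) ((by - ay) * (cx - ax)) ⟩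
    fromℤ ((bx - ax) * (cy - ay)) ℚ.- fromℤ ((by - ay) * (cx - ax))
      ≡⟨ cong₂ ℚ._-_ (fromℤ-* (bx - ax) (cy - ay)) (fromℤ-* (by - ay) (cx - ax)) ⟩
    fromℤ (bx - ax) ℚ.* fromℤ (cy - ay) ℚ.- fromℤ (by - ay) ℚ.* fromℤ (cx - ax)
      ≡⟨ cong₂ ℚ._-_ (cong₂ ℚ._*_ (fromℤ-- bx ax) (fromℤ-- cy ay))
                     (cong₂ ℚ._*_ (fromℤ-- by ay) (fromℤ-- cx ax)) ⟩
    orientation (fromℤ ax , fromℤ ay) (fromℤ bx , fromℤ by) (fromℤ cx , fromℤ cy) ∎)
    where open ≡-Reasoning

  orientation-cubicPoint : ∀ x y z →
    orientation (cubicPoint x) (cubicPoint y) (cubicPoint z) ≡ fromℤ ((y - x) * ((z - x) * (z - y) * σ₂ x y z))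
  orientation-cubicPoint x y z =
    trans (orientation-fromℤ (x * x) (x * x * x) (y * y) (y * y * y) (z * z) (z * z * z)) (cong fromℤ (factorisation x y z))
    where
    factorisation : ∀ x y z → (y * y - x * x) * (z * z * z - x * x * x) - (y * y * y - x * x * x) * (z * z - x * x)
                            ≡ (y - x) * ((z - x) * (z - y) * (x * y + x * z + y * z))
    factorisation = solve-∀

  record HasSign (s : Sign) (z : ℤ) : Set where
    constructor hasSign
    field
      k       : ℕ
      z≡s◃1+k : z ≡ s ◃ suc k

  *-hasSign : ∀ {s t x y} → HasSign s x → HasSign t y → HasSign (s Sign.* t) (x * y)
  *-hasSign {s} {t} (hasSign k refl) (hasSign l refl) = hasSign _ (sym (ℤₚ.◃-distrib-* s t (suc k) (suc l)))

  hasSign⇒fromℤ≢0 : ∀ {s x} → HasSign s x → fromℤ x ≢ 0ℚ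
  hasSign⇒fromℤ≢0 {Sign.+} (hasSign k refl) ()
  hasSign⇒fromℤ≢0 {Sign.-} (hasSign k refl) ()

  sameSign-fromℤ : ∀ {s x y} → HasSign s x → HasSign s y → SameSign (fromℤ x) (fromℤ y)
  sameSign-fromℤ {Sign.+} (hasSign k refl) (hasSign l refl) =
    inj₁ (ℚ.*<* (ℤ.+<+ (s≤s z≤n)) , ℚ.*<* (ℤ.+<+ (s≤s z≤n)))
  sameSign-fromℤ {Sign.-} (hasSign k refl) (hasSign l refl) = inj₂ (ℚ.*<* ℤ.-<+ , ℚ.*<* ℤ.-<+)

  <⇒hasSign⁺ : ∀ {x y} → x < y → HasSign Sign.+ (y - x)
  <⇒hasSign⁺ {x} {y} x<y = positive (y - x) (subst (_< y - x) (ℤₚ.+-inverseʳ x) (ℤₚ.+-monoˡ-< (- x) x<y))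
    where
    positive : ∀ z → + 0 < z → HasSign Sign.+ z
    positive +[1+ k ] _ = hasSign k refl
    positive (+ 0) (ℤ.+<+ ())

  >⇒hasSign⁻ : ∀ {x y} → y < x → HasSign Sign.- (y - x)
  >⇒hasSign⁻ {x} {y} y<x = negative (y - x) (subst (y - x <_) (ℤₚ.+-inverseʳ x) (ℤₚ.+-monoˡ-< (- x) y<x))
    where
    negative : ∀ z → z < + 0 → HasSign Sign.- z
    negative -[1+ k ] _ = hasSign k refl
    negative (+ 0) (ℤ.+<+ ())

open CubicCurve

module SignsOfσ₂ where
  open import Data.Nat using (_+_; _*_; _<_; >-nonZero)
  open import Data.Nat.Properties
  open import Data.Nat.Tactic.RingSolver using (solve-∀)
  open import Data.Integer as ℤ using (+_)
  import Data.Integer.Properties as ℤₚ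
  import Data.Integer.Tactic.RingSolver as ℤ-Solver
  open import Data.Sign as Sign using (Sign)

  r*[p+q]<p*q : ∀ {p q r} → 2 * r < p → 2 * r < q → r * (p + q) < p * q
  r*[p+q]<p*q {p} {q} {r} 2r<p 2r<q = *-cancelˡ-< 2 _ _ (begin-strict
    2 * (r * (p + q))         ≡⟨ expand r p q ⟩
    2 * r * p + 2 * r * q     <⟨ +-mono-< (*-monoˡ-< p 2r<q) (*-monoˡ-< q 2r<p) ⟩
    q * p + p * q             ≡⟨ double p q ⟩
    2 * (p * q)               ∎)
    where
    open ≤-Reasoning
    instance _ = >-nonZero (≤-<-trans z≤n 2r<p)
    instance _ = >-nonZero (≤-<-trans z≤n 2r<q)
    expand : ∀ r p q → 2 * (r * (p + q)) ≡ 2 * r * p + 2 * r * q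
    expand = solve-∀
    double : ∀ p q → q * p + p * q ≡ 2 * (p * q)
    double = solve-∀

  p*q<r*[p+q] : ∀ {p q r m} → p ≤ m → q ≤ m → m < 2 * r → 0 < p + q → p * q < r * (p + q)
  p*q<r*[p+q] {p} {q} {r} {m} p≤m q≤m m<2r 0<p+q = *-cancelˡ-< 2 _ _ (begin-strict
    2 * (p * q)               ≡⟨ double p q ⟩
    p * q + p * q             ≤⟨ +-mono-≤ (*-monoʳ-≤ p q≤m) (*-monoˡ-≤ q p≤m) ⟩
    p * m + m * q             ≡⟨ collect p q m ⟩
    m * (p + q)               <⟨ *-monoˡ-< (p + q) m<2r ⟩
    2 * r * (p + q)           ≡⟨ *-assoc 2 r (p + q) ⟩
    2 * (r * (p + q))         ∎)
    where
    open ≤-Reasoning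
    instance _ = >-nonZero 0<p+q
    double : ∀ p q → 2 * (p * q) ≡ p * q + p * q
    double = solve-∀
    collect : ∀ p q m → p * m + m * q ≡ m * (p + q)
    collect = solve-∀

  σ₂-comm₁₂ : ∀ x y z → σ₂ x y z ≡ σ₂ y x z
  σ₂-comm₁₂ = swap
    where
    swap : ∀ x y z → x ℤ.* y ℤ.+ x ℤ.* z ℤ.+ y ℤ.* z ≡ y ℤ.* x ℤ.+ y ℤ.* z ℤ.+ x ℤ.* z
    swap = ℤ-Solver.solve-∀

  σ₂-comm₂₃ : ∀ x y z → σ₂ x y z ≡ σ₂ x z y
  σ₂-comm₂₃ = swap
    where
    swap : ∀ x y z → x ℤ.* y ℤ.+ x ℤ.* z ℤ.+ y ℤ.* z ≡ x ℤ.* z ℤ.+ x ℤ.* y ℤ.+ z ℤ.* y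
    swap = ℤ-Solver.solve-∀

  σ₂-pos : ∀ p q r → σ₂ (+ p) (+ q) (+ r) ≡ + (p * q + p * r + q * r)
  σ₂-pos p q r = sym (begin
    + (p * q + p * r + q * r)           ≡⟨ ℤₚ.pos-+ (p * q + p * r) (q * r) ⟩
    + (p * q + p * r) ℤ.+ + (q * r)     ≡⟨ cong (ℤ._+ + (q * r)) (ℤₚ.pos-+ (p * q) (p * r)) ⟩
    + (p * q) ℤ.+ + (p * r) ℤ.+ + (q * r)
      ≡⟨ cong₂ ℤ._+_ (cong₂ ℤ._+_ (ℤₚ.pos-* p q) (ℤₚ.pos-* p r)) (ℤₚ.pos-* q r) ⟩
    σ₂ (+ p) (+ q) (+ r)                ∎)
    where open ≡-Reasoning

  σ₂-neg : ∀ x y z → σ₂ (ℤ.- x) (ℤ.- y) (ℤ.- z) ≡ σ₂ x y z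
  σ₂-neg = negate
    where
    negate : ∀ x y z → (ℤ.- x) ℤ.* (ℤ.- y) ℤ.+ (ℤ.- x) ℤ.* (ℤ.- z) ℤ.+ (ℤ.- y) ℤ.* (ℤ.- z)
                     ≡ x ℤ.* y ℤ.+ x ℤ.* z ℤ.+ y ℤ.* z
    negate = ℤ-Solver.solve-∀

  σ₂-neg-neg-pos : ∀ p q r → σ₂ (ℤ.- + p) (ℤ.- + q) (+ r) ≡ + (p * q) ℤ.- + (r * (p + q))
  σ₂-neg-neg-pos p q r = begin
    σ₂ (ℤ.- + p) (ℤ.- + q) (+ r)
      ≡⟨ expand (+ p) (+ q) (+ r) ⟩
    + p ℤ.* + q ℤ.- + r ℤ.* (+ p ℤ.+ + q)
      ≡⟨ cong₂ ℤ._-_ (sym (ℤₚ.pos-* p q)) (trans (cong (+ r ℤ.*_) (sym (ℤₚ.pos-+ p q))) (sym (ℤₚ.pos-* r (p + q)))) ⟩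
    + (p * q) ℤ.- + (r * (p + q)) ∎
    where
    open ≡-Reasoning
    expand : ∀ x y z → (ℤ.- x) ℤ.* (ℤ.- y) ℤ.+ (ℤ.- x) ℤ.* z ℤ.+ (ℤ.- y) ℤ.* z
                     ≡ x ℤ.* y ℤ.- z ℤ.* (x ℤ.+ y)
    expand = ℤ-Solver.solve-∀

  σ₂-neg-pos-pos : ∀ p q r → σ₂ (ℤ.- + p) (+ q) (+ r) ≡ + (q * r) ℤ.- + (p * (q + r))
  σ₂-neg-pos-pos p q r = begin
    σ₂ (ℤ.- + p) (+ q) (+ r)
      ≡⟨ expand (+ p) (+ q) (+ r) ⟩
    + q ℤ.* + r ℤ.- + p ℤ.* (+ q ℤ.+ + r)
      ≡⟨ cong₂ ℤ._-_ (sym (ℤₚ.pos-* q r)) (trans (cong (+ p ℤ.*_) (sym (ℤₚ.pos-+ q r))) (sym (ℤₚ.pos-* p (q + r)))) ⟩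
    + (q * r) ℤ.- + (p * (q + r)) ∎
    where
    open ≡-Reasoning
    expand : ∀ x y z → (ℤ.- x) ℤ.* y ℤ.+ (ℤ.- x) ℤ.* z ℤ.+ y ℤ.* z ≡ y ℤ.* z ℤ.- x ℤ.* (y ℤ.+ z)
    expand = ℤ-Solver.solve-∀

  σ₂-pos-hasSign : ∀ p q r → 0 < p → 0 < q → HasSign Sign.+ (σ₂ (+ p) (+ q) (+ r))
  σ₂-pos-hasSign (suc p) (suc q) r _ _ = hasSign _ (σ₂-pos (suc p) (suc q) r)

  σ₂-neg-hasSign : ∀ p q r → 0 < p → 0 < q → HasSign Sign.+ (σ₂ (ℤ.- + p) (ℤ.- + q) (ℤ.- + r))
  σ₂-neg-hasSign p q r 0<p 0<q = subst (HasSign Sign.+) (sym (σ₂-neg (+ p) (+ q) (+ r))) (σ₂-pos-hasSign p q r 0<p 0<q)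

  σ₂-neg-neg-pos-hasSign⁺ : ∀ p q r → 2 * r < p → 2 * r < q → HasSign Sign.+ (σ₂ (ℤ.- + p) (ℤ.- + q) (+ r))
  σ₂-neg-neg-pos-hasSign⁺ p q r 2r<p 2r<q = subst (HasSign Sign.+) (sym (σ₂-neg-neg-pos p q r))
    (<⇒hasSign⁺ (ℤ.+<+ (r*[p+q]<p*q {r = r} 2r<p 2r<q)))

  σ₂-neg-neg-pos-hasSign⁻ : ∀ p q r {m} → p ≤ m → q ≤ m → m < 2 * r → 0 < p + q →
    HasSign Sign.- (σ₂ (ℤ.- + p) (ℤ.- + q) (+ r))
  σ₂-neg-neg-pos-hasSign⁻ p q r p≤m q≤m m<2r 0<p+q = subst (HasSign Sign.-) (sym (σ₂-neg-neg-pos p q r))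
    (>⇒hasSign⁻ (ℤ.+<+ (p*q<r*[p+q] {r = r} p≤m q≤m m<2r 0<p+q)))

  σ₂-neg-pos-pos-hasSign⁻ : ∀ p q r {m} → q ≤ m → r ≤ m → m < 2 * p → 0 < q + r →
    HasSign Sign.- (σ₂ (ℤ.- + p) (+ q) (+ r))
  σ₂-neg-pos-pos-hasSign⁻ p q r q≤m r≤m m<2p 0<q+r = subst (HasSign Sign.-) (sym (σ₂-neg-pos-pos p q r))
    (>⇒hasSign⁻ (ℤ.+<+ (p*q<r*[p+q] {r = p} q≤m r≤m m<2p 0<q+r)))

open SignsOfσ₂

module CrossingPatterns where
  open import Data.Nat using (_+_)
  open import Data.Bool using (Bool; true; false; not; _∧_; _∨_; T; if_then_else_)
  open import Data.Bool.ListAction using (any)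
  open import Data.List using (List; []; _∷_; map; cartesianProductWith)
  open import Data.List.Membership.Propositional using (_∈_)
  open import Data.List.Membership.Propositional.Properties using (∈-map⁺; ∈-cartesianProductWith⁺)
  open import Data.List.Relation.Unary.Any using (here; there)
  import Data.List.Relation.Unary.All as All
  open import Data.List.Relation.Unary.All.Properties using (all⁺)
  open import Data.Sign as Sign using (Sign)
  open import Function using (_$_)

  data Class : Set where
    A B C : Class

  -- Read off from the parameter ranges: a single A-parameter makes σ₂ negative, two make it
  -- positive next to a B-parameter and negative next to a C-parameter.
  σ₂-sign : Class → Class → Class → Sign
  σ₂-sign c₁ c₂ c₃ = signFor (#A c₁ + #A c₂ + #A c₃) (isC c₁ ∨ isC c₂ ∨ isC c₃)
    where
    #A : Class → ℕ
    #A A = 1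
    #A _ = 0
    isC : Class → Bool
    isC C = true
    isC _ = false
    signFor : ℕ → Bool → Sign
    signFor 1 _    = Sign.-
    signFor 2 true = Sign.-
    signFor _ _    = Sign.+

  orderSign : Bool → Sign
  orderSign true  = Sign.+
  orderSign false = Sign.-

  -- The sign of the orientation of (p, q, r) for p < q, from the factors (r - p), (r - q) and σ₂.
  sideSign : Bool → Bool → Class → Class → Class → Sign
  sideSign p<r q<r cp cq cr = orderSign p<r Sign.* orderSign q<r Sign.* σ₂-sign cp cq cr

  _≠ˢ_ : Sign → Sign → Bool
  Sign.+ ≠ˢ Sign.- = true
  Sign.- ≠ˢ Sign.+ = true
  _      ≠ˢ _      = false

  infixr 4 _⇒ᵇ_
  _⇒ᵇ_ : Bool → Bool → Bool
  true  ⇒ᵇ b = b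
  false ⇒ᵇ _ = true

  _≤ᶜ_ : Class → Class → Bool
  A ≤ᶜ _ = true
  B ≤ᶜ A = false
  B ≤ᶜ _ = true
  C ≤ᶜ C = true
  C ≤ᶜ _ = false

  ordered : Bool → Class → Class → Bool
  ordered p<q cp cq = if p<q then cp ≤ᶜ cq else cq ≤ᶜ cp

  -- The order type of an edge uv (u < v) and an edge xy (x < y) with four distinct endpoints.
  record Pattern : Set where
    constructor mkPattern
    field
      u<x u<y v<x v<y : Bool
      cu cv cx cy : Class

  realisable : Pattern → Bool
  realisable P =
    (v<x ⇒ᵇ u<x) ∧ (v<y ⇒ᵇ u<y) ∧ (u<x ⇒ᵇ u<y) ∧ (v<x ⇒ᵇ v<y) ∧ cu ≤ᶜ cv ∧ cx ≤ᶜ cy ∧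
    ordered u<x cu cx ∧ ordered u<y cu cy ∧ ordered v<x cv cx ∧ ordered v<y cv cy
    where open Pattern P

  -- Seen from the edge xy the roles swap: x < u is not (u < x), the endpoints being distinct.
  crossing : Pattern → Bool
  crossing P =
    (sideSign u<x v<x cu cv cx ≠ˢ sideSign u<y v<y cu cv cy) ∧
    (sideSign (not u<x) (not u<y) cx cy cu ≠ˢ sideSign (not v<x) (not v<y) cx cy cv)
    where open Pattern P

  -- The positions 0, a, a + b, n, u, u + 1, v, v + 1 (Boxes.position); a box is
  -- [xFrom, xTo) × [yFrom, yTo).
  data Landmark : Set where
    start startB startC end atU afterU atV afterV : Landmark

  landmark≤ : Landmark → Bool → Bool → Class → Bool
  landmark≤ start  _   _   _  = true
  landmark≤ startB _   _   cx = B ≤ᶜ cx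
  landmark≤ startC _   _   cx = C ≤ᶜ cx
  landmark≤ end    _   _   _  = false
  landmark≤ atU    u<x _   _  = u<x
  landmark≤ afterU u<x _   _  = u<x
  landmark≤ atV    _   v<x _  = v<x
  landmark≤ afterV _   v<x _  = v<x

  inRange : Landmark → Landmark → Bool → Bool → Class → Bool
  inRange from to u<x v<x cx = landmark≤ from u<x v<x cx ∧ not (landmark≤ to u<x v<x cx)

  record Box : Set where
    constructor box
    field
      xFrom xTo yFrom yTo : Landmark

  inBox : Pattern → Box → Bool
  inBox P (box x₀ x₁ y₀ y₁) = inRange x₀ x₁ u<x v<x cx ∧ inRange y₀ y₁ u<y v<y cy
    where open Pattern P

  boxes : Class → Class → List Box
  boxes A A = box start atU afterU atV ∷ box afterU atV afterV startC ∷ []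
  boxes B B = box startB atU afterU atV ∷ box afterU atV afterV end ∷ []
  boxes C C = box startB atU afterU atV ∷ box afterU atV afterV end ∷ []
  boxes A B = box start atU afterU startB ∷ box afterU startB startB atV ∷ box start atU afterV startC ∷ []
  boxes A C = box afterU startB afterV end ∷ box start atU startC atV ∷ []
  boxes B C = box startB atU afterU startC ∷ box afterU startC afterV end ∷
              box startB atU startC atV ∷ box startC atV afterV end ∷ []
  boxes _ _ = []

  covered : Pattern → Bool
  covered P = any (inBox P) (boxes (Pattern.cu P) (Pattern.cv P))

  bools : List Bool
  bools = true ∷ false ∷ []

  ∈-bools : ∀ b → b ∈ bools
  ∈-bools true  = here refl
  ∈-bools false = there (here refl)

  classes : List Class
  classes = A ∷ B ∷ C ∷ []

  ∈-classes : ∀ c → c ∈ classes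
  ∈-classes A = here refl
  ∈-classes B = there (here refl)
  ∈-classes C = there (there (here refl))

  infixl 5 _⊛_
  _⊛_ : ∀ {X Y : Set} → List (X → Y) → List X → List Y
  _⊛_ = cartesianProductWith _$_

  patterns : List Pattern
  patterns = map mkPattern bools ⊛ bools ⊛ bools ⊛ bools ⊛ classes ⊛ classes ⊛ classes ⊛ classes

  ∈-patterns : ∀ P → P ∈ patterns
  ∈-patterns (mkPattern ux uy vx vy cu cv cx cy) =
    ∈-⊛ (∈-⊛ (∈-⊛ (∈-⊛ (∈-⊛ (∈-⊛ (∈-⊛ (∈-map⁺ mkPattern (∈-bools ux))
      (∈-bools uy)) (∈-bools vx)) (∈-bools vy)) (∈-classes cu)) (∈-classes cv)) (∈-classes cx)) (∈-classes cy)
    where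
    ∈-⊛ : ∀ {X Y : Set} {f : X → Y} {fs x xs} → f ∈ fs → x ∈ xs → f x ∈ fs ⊛ xs
    ∈-⊛ = ∈-cartesianProductWith⁺ _$_

  crossing⇒covered : Pattern → Bool
  crossing⇒covered P = realisable P ⇒ᵇ crossing P ⇒ᵇ covered P

  -- By evaluation on all 2⁴ · 3⁴ patterns.
  crossing-patterns-covered : ∀ P → T (realisable P) → T (crossing P) → T (covered P)
  crossing-patterns-covered P realisableP crossingP =
    ⇒ᵇ-elim (⇒ᵇ-elim (All.lookup (all⁺ crossing⇒covered patterns _) (∈-patterns P)) realisableP) crossingP
    where
    ⇒ᵇ-elim : ∀ {a b} → T (a ⇒ᵇ b) → T a → T b
    ⇒ᵇ-elim {true} h _ = h

open CrossingPatterns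

module Counting where
  open import Data.Nat using (_+_; _*_; _∸_; _<_)
  open import Data.Nat.Properties using (≤-trans; ≤-reflexive; m+[n∸m]≡n; ∸-monoˡ-<)
  open import Data.List using (List; []; _∷_; length; map; _++_; applyUpTo; cartesianProduct; concatMap)
  open import Data.Nat.ListAction using (sum)
  open import Data.List.Properties using (length-++; length-map; length-applyUpTo)
  open import Data.List.Membership.Propositional using (_∈_)
  open import Data.List.Membership.Propositional.Properties using (∈-applyUpTo⁺)
  open import Data.List.Relation.Binary.Subset.Propositional using (_⊆_)
  open import Data.List.Relation.Unary.Any using (here; there)
  import Data.List.Relation.Unary.All as All
  open import Data.List.Relation.Unary.Unique.Propositional using (Unique; []; _∷_)

  private
    remove : ∀ {X : Set} {x : X} xs → x ∈ xs → List X
    remove (_ ∷ xs) (here _)  = xs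
    remove (y ∷ xs) (there p) = y ∷ remove xs p

    length-remove : ∀ {X : Set} {x : X} xs (x∈xs : x ∈ xs) → length xs ≡ suc (length (remove xs x∈xs))
    length-remove (_ ∷ _)  (here _)  = refl
    length-remove (_ ∷ xs) (there p) = cong suc (length-remove xs p)

    ∈-remove : ∀ {X : Set} {x z : X} {xs} → z ∈ xs → z ≢ x → (x∈xs : x ∈ xs) → z ∈ remove xs x∈xs
    ∈-remove (here refl) z≢x (here refl) = ⊥-elim (z≢x refl)
    ∈-remove (here z≡y)  _   (there _)   = here z≡y
    ∈-remove (there z∈)  _   (here _)    = z∈
    ∈-remove (there z∈)  z≢x (there p)   = there (∈-remove z∈ z≢x p)

  unique-⊆⇒length≤ : ∀ {X : Set} {xs ys : List X} → Unique xs → xs ⊆ ys → length xs ≤ length ys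
  unique-⊆⇒length≤ {xs = []}     _              _     = z≤n
  unique-⊆⇒length≤ {xs = x ∷ xs} {ys} (x∉xs ∷ uniq) xs⊆ys =
    ≤-trans (s≤s (unique-⊆⇒length≤ uniq xs⊆ys-x)) (≤-reflexive (sym (length-remove ys x∈ys)))
    where
    x∈ys = xs⊆ys (here refl)
    xs⊆ys-x : xs ⊆ remove ys x∈ys
    xs⊆ys-x z∈xs = ∈-remove (xs⊆ys (there z∈xs)) (λ z≡x → All.lookup x∉xs z∈xs (sym z≡x)) x∈ys

  range : ℕ → ℕ → List ℕ
  range from to = applyUpTo (from +_) (to ∸ from)

  ∈-range : ∀ {from to x} → from ≤ x → x < to → x ∈ range from to
  ∈-range {from} {to} {x} from≤x x<to =
    subst (_∈ range from to) (m+[n∸m]≡n from≤x) (∈-applyUpTo⁺ (from +_) (∸-monoˡ-< x<to from≤x))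

  length-range : ∀ from to → length (range from to) ≡ to ∸ from
  length-range from to = length-applyUpTo (from +_) (to ∸ from)

  length-cartesianProduct : ∀ {X Y : Set} (xs : List X) (ys : List Y) →
    length (cartesianProduct xs ys) ≡ length xs * length ys
  length-cartesianProduct []       ys = refl
  length-cartesianProduct (x ∷ xs) ys = trans (length-++ (map (x ,_) ys))
    (cong₂ _+_ (length-map (x ,_) ys) (length-cartesianProduct xs ys))

  length-concatMap : ∀ {X Y : Set} (f : X → List Y) xs → length (concatMap f xs) ≡ sum (map (λ x → length (f x)) xs)
  length-concatMap f []       = refl
  length-concatMap f (x ∷ xs) = trans (length-++ (f x)) (cong (length (f x) +_) (length-concatMap f xs))

open Counting

module AreaInequalities where
  open import Data.Nat using (_+_; _*_)
  open import Data.Nat.Properties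
  open import Data.Nat.Tactic.RingSolver using (solve-∀)
  open ≤-Reasoning

  same-class-area : ∀ j d r c m → d ≤ m → c ≤ suc m → j * d + d * (r + c) ≤ suc (j + d + r) * m
  same-class-area j d r c m d≤m c≤1+m = begin
    j * d + d * (r + c)               ≤⟨ +-monoʳ-≤ (j * d) (*-monoʳ-≤ d (+-monoʳ-≤ r c≤1+m)) ⟩
    j * d + d * (r + suc m)           ≡⟨ regroup j d r m ⟩
    d * suc (j + r) + d * m           ≤⟨ +-monoˡ-≤ (d * m) (*-monoˡ-≤ (suc (j + r)) d≤m) ⟩
    m * suc (j + r) + d * m           ≡⟨ collect j d r m ⟩
    suc (j + d + r) * m               ∎
    where
    regroup : ∀ j d r m → j * d + d * (r + suc m) ≡ d * suc (j + r) + d * m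
    regroup = solve-∀
    collect : ∀ j d r m → m * suc (j + r) + d * m ≡ suc (j + d + r) * m
    collect = solve-∀

  u*i≤u*j+i*k : ∀ u i j k → u + i ≤ suc (j + k) → u * i ≤ u * j + i * k
  u*i≤u*j+i*k u        zero    j k _ = ≤-trans (≤-reflexive (*-zeroʳ u)) z≤n
  u*i≤u*j+i*k zero     (suc i) j k _ = z≤n
  u*i≤u*j+i*k (suc u′) (suc i′) j k u+i≤1+j+k with ≤-total (suc u′) (suc i′)
  ... | inj₁ u≤i = begin
    u * i             ≤⟨ *-monoʳ-≤ u i≤j+k ⟩
    u * (j + k)       ≡⟨ *-distribˡ-+ u j k ⟩
    u * j + u * k     ≤⟨ +-monoʳ-≤ (u * j) (*-monoˡ-≤ k u≤i) ⟩
    u * j + i * k     ∎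
    where
    u = suc u′
    i = suc i′
    i≤j+k : i ≤ j + k
    i≤j+k = ≤-trans (m≤n+m i u′) (≤-pred u+i≤1+j+k)
  ... | inj₂ i≤u = begin
    u * i             ≡⟨ *-comm u i ⟩
    i * u             ≤⟨ *-monoʳ-≤ i u≤j+k ⟩
    i * (j + k)       ≡⟨ *-distribˡ-+ i j k ⟩
    i * j + i * k     ≤⟨ +-monoˡ-≤ (i * k) (*-monoˡ-≤ j i≤u) ⟩
    u * j + i * k     ∎
    where
    u = suc u′
    i = suc i′
    u≤j+k : u ≤ j + k
    u≤j+k = ≤-trans (m≤m+n u i′) (≤-pred (subst (_≤ suc (j + k)) (+-suc u i′) u+i≤1+j+k))

  adjacent-classes-area : ∀ u i j k → u + i ≤ suc (j + k) → u * i + (i * j + u * k) ≤ (u + i) * (j + k)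
  adjacent-classes-area u i j k u+i≤1+j+k = begin
    u * i + (i * j + u * k)           ≤⟨ +-monoˡ-≤ (i * j + u * k) (u*i≤u*j+i*k u i j k u+i≤1+j+k) ⟩
    u * j + i * k + (i * j + u * k)   ≡⟨ expand u i j k ⟩
    (u + i) * (j + k)                 ∎
    where
    expand : ∀ u i j k → u * j + i * k + (i * j + u * k) ≡ (u + i) * (j + k)
    expand = solve-∀

  distant-classes-area : ∀ u i k k′ m → k + k′ ≤ m → i * k′ + u * k ≤ (u + i) * m
  distant-classes-area u i k k′ m k+k′≤m = begin
    i * k′ + u * k                        ≤⟨ m≤m+n (i * k′ + u * k) (u * k′ + i * k) ⟩
    i * k′ + u * k + (u * k′ + i * k)     ≡⟨ expand u i k k′ ⟩
    (u + i) * (k + k′)                    ≤⟨ *-monoʳ-≤ (u + i) k+k′≤m ⟩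
    (u + i) * m                           ∎
    where
    expand : ∀ u i k k′ → i * k′ + u * k + (u * k′ + i * k) ≡ (u + i) * (k + k′)
    expand = solve-∀

  4xy≤[x+y]² : ∀ x y → 4 * (x * y) ≤ (x + y) * (x + y)
  4xy≤[x+y]² x y with ≤-total x y
  ... | inj₁ x≤y with t , refl ← m≤n⇒∃[o]m+o≡n x≤y =
    subst (4 * (x * (x + t)) ≤_) (sym (square x t)) (m≤m+n (4 * (x * (x + t))) (t * t))
    where
    square : ∀ x t → (x + (x + t)) * (x + (x + t)) ≡ 4 * (x * (x + t)) + t * t
    square = solve-∀
  ... | inj₂ y≤x with t , refl ← m≤n⇒∃[o]m+o≡n y≤x =
    subst (4 * ((y + t) * y) ≤_) (sym (square y t)) (m≤m+n (4 * ((y + t) * y)) (t * t))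
    where
    square : ∀ y t → (y + t + y) * (y + t + y) ≡ 4 * ((y + t) * y) + t * t
    square = solve-∀

  B-to-C-area : ∀ j j′ k k′ m → k + k′ ≤ j + j′ → j + j′ ≤ m →
    j * j′ + (j′ * k′ + (j * k + k * k′)) ≤ m * (j + j′)
  B-to-C-area j j′ k k′ m k+k′≤b j+j′≤m = begin
    j * j′ + (j′ * k′ + (j * k + k * k′))   ≡⟨ factor j j′ k k′ ⟩
    (j + k′) * (j′ + k)                      ≤⟨ *-cancelˡ-≤ 4 (≤-trans (4xy≤[x+y]² (j + k′) (j′ + k)) 4b≥sum²) ⟩
    (j + j′) * (j + j′)                      ≤⟨ *-monoˡ-≤ (j + j′) j+j′≤m ⟩
    m * (j + j′)                             ∎
    where
    factor : ∀ j j′ k k′ → j * j′ + (j′ * k′ + (j * k + k * k′)) ≡ (j + k′) * (j′ + k)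
    factor = solve-∀
    regroup : ∀ j j′ k k′ → j + k′ + (j′ + k) ≡ j + j′ + (k + k′)
    regroup = solve-∀
    double² : ∀ x → (x + x) * (x + x) ≡ 4 * (x * x)
    double² = solve-∀
    sum≤2b : j + k′ + (j′ + k) ≤ (j + j′) + (j + j′)
    sum≤2b = subst (_≤ (j + j′) + (j + j′)) (sym (regroup j j′ k k′)) (+-monoʳ-≤ (j + j′) k+k′≤b)
    4b≥sum² : (j + k′ + (j′ + k)) * (j + k′ + (j′ + k)) ≤ 4 * ((j + j′) * (j + j′))
    4b≥sum² = ≤-trans (*-mono-≤ sum≤2b sum≤2b) (≤-reflexive (double² (j + j′)))

open AreaInequalities

module Boxes (a b c u v : ℕ) where
  open import Data.Nat using (_+_; _*_; _∸_)
  open import Data.List using (List; length; map; cartesianProduct; concatMap)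
  open import Data.List.Properties using (map-cong)
  open import Data.Nat.ListAction using (sum)

  position : Landmark → ℕ
  position start  = 0
  position startB = a
  position startC = a + b
  position end    = a + b + c
  position atU    = u
  position afterU = suc u
  position atV    = v
  position afterV = suc v

  boxPairs : Box → List (ℕ × ℕ)
  boxPairs (box x₀ x₁ y₀ y₁) =
    cartesianProduct (range (position x₀) (position x₁)) (range (position y₀) (position y₁))

  boxArea : Box → ℕ
  boxArea (box x₀ x₁ y₀ y₁) = (position x₁ ∸ position x₀) * (position y₁ ∸ position y₀)

  length-boxPairs : ∀ X → length (boxPairs X) ≡ boxArea X
  length-boxPairs (box x₀ x₁ y₀ y₁) =
    trans (length-cartesianProduct (range (position x₀) (position x₁)) (range (position y₀) (position y₁)))
          (cong₂ _*_ (length-range (position x₀) (position x₁)) (length-range (position y₀) (position y₁)))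

  candidates : Class → Class → List (ℕ × ℕ)
  candidates cu cv = concatMap boxPairs (boxes cu cv)

  totalArea : Class → Class → ℕ
  totalArea cu cv = sum (map boxArea (boxes cu cv))

  length-candidates : ∀ cu cv → length (candidates cu cv) ≡ totalArea cu cv
  length-candidates cu cv =
    trans (length-concatMap boxPairs (boxes cu cv)) (cong sum (map-cong length-boxPairs (boxes cu cv)))

open Boxes using (candidates; totalArea)

module TotalAreaBounds where
  open import Data.Nat using (_+_; _*_; _∸_; _<_)
  open import Data.Nat.Properties
  open import Data.Nat.Tactic.RingSolver using (solve-∀)
  open ≤-Reasoning

  private
    gap : ∀ {m n} → m ≤ n → ∃ λ k → m + k ≡ n
    gap m≤n = m≤n⇒∃[o]m+o≡n m≤n

    ∸-≡ : ∀ {m n k} → m + k ≡ n → n ∸ m ≡ k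
    ∸-≡ {m} {k = k} refl = m+n∸m≡n m k

    m+n+o∸m≡n+o : ∀ m n o → m + n + o ∸ m ≡ n + o
    m+n+o∸m≡n+o m n o = ∸-≡ {m} (sym (+-assoc m n o))

    suc[x+j]+k≡x+[suc-j+k] : ∀ x j k → suc (x + j) + k ≡ x + (suc j + k)
    suc[x+j]+k≡x+[suc-j+k] x j k = trans (cong suc (+-assoc x j k)) (sym (+-suc x (j + k)))

    2+[x+j]+d+r≡x+[2+j+d+r] : ∀ x j d r → suc (suc (x + j) + d) + r ≡ x + (suc (suc (j + d)) + r)
    2+[x+j]+d+r≡x+[2+j+d+r] = solve-∀

    cancel-suc : ∀ x {m n} → suc (x + m) ≤ x + n → suc m ≤ n
    cancel-suc x {m} {n} le = +-cancelˡ-≤ x _ _ (subst (_≤ x + n) (sym (+-suc x m)) le)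

    cancel-suc² : ∀ x {j d n} → suc (suc (x + j) + d) ≤ x + n → suc (suc (j + d)) ≤ n
    cancel-suc² x {j} {d} {n} le = +-cancelˡ-≤ x _ _ (subst (_≤ x + n) (shift x j d) le)
      where
      shift : ∀ x j d → suc (suc (x + j) + d) ≡ x + suc (suc (j + d))
      shift = solve-∀

    same-class-shape : ∀ {x x′ y y′ z z′} → x ≡ x′ → y ≡ y′ → z ≡ z′ →
      x * y + (y * z + 0) ≡ x′ * y′ + y′ * z′
    same-class-shape {x} {y = y} {z = z} refl refl refl = cong (x * y +_) (+-identityʳ (y * z))

    A-to-B-shape : ∀ u {x x′ y y′ z z′} → x ≡ x′ → y ≡ y′ → z ≡ z′ →
      u * x + (x * y + (u * z + 0)) ≡ u * x′ + (x′ * y′ + u * z′)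
    A-to-B-shape u {x} {y = y} {z = z} refl refl refl = cong (λ t → u * x + (x * y + t)) (+-identityʳ (u * z))

    A-to-C-shape : ∀ u {x x′ y y′ z z′} → x ≡ x′ → y ≡ y′ → z ≡ z′ →
      x * y + (u * z + 0) ≡ x′ * y′ + u * z′
    A-to-C-shape u {x} {y = y} {z = z} refl refl refl = cong (x * y +_) (+-identityʳ (u * z))

    B-to-C-shape : ∀ {x x′ y y′ z z′ w w′} → x ≡ x′ → y ≡ y′ → z ≡ z′ → w ≡ w′ →
      x * y + (y * w + (x * z + (z * w + 0))) ≡ x′ * y′ + (y′ * w′ + (x′ * z′ + z′ * w′))
    B-to-C-shape {x} {y = y} {z = z} {w = w} refl refl refl refl =
      cong (λ t → x * y + (y * w + (x * z + t))) (+-identityʳ (z * w))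

  totalArea-AA : ∀ {a b c u v} → a ≤ suc b → u < v → v < a → totalArea a b c u v A A ≤ (a ∸ 1) * (b ∸ 1)
  totalArea-AA {c = c} {u = u} a≤1+b u<v v<a
    with d , refl ← gap u<v
    with r , refl ← gap v<a
    with b′ , refl ← gap (≤-pred (≤-trans (s≤s (s≤s z≤n)) a≤1+b)) = begin
      totalArea (suc (suc u + d) + r) (suc b′) c u (suc u + d) A A
        ≡⟨ same-class-shape (refl {x = u}) (m+n∸m≡n (suc u) d) (m+n+o∸m≡n+o (suc (suc u + d)) r (suc b′)) ⟩
      u * d + d * (r + suc b′)   ≤⟨ same-class-area u d r (suc b′) b′ d≤b′ ≤-refl ⟩
      suc (u + d + r) * b′       ∎
    where
    d≤b′ : d ≤ b′
    d≤b′ = ≤-trans (≤-trans (m≤n+m d u) (m≤m+n (u + d) r)) (≤-pred (≤-pred a≤1+b))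

  totalArea-BB : ∀ {a b c u v} → 1 ≤ a → c ≤ a → b ≤ a → a ≤ u → u < v → v < a + b →
    totalArea a b c u v B B ≤ (a ∸ 1) * (b ∸ 1)
  totalArea-BB {c = c} 1≤a c≤a b≤a a≤u u<v v<a+b
    with a′ , refl ← gap 1≤a
    with j , refl ← gap a≤u
    with d , refl ← gap u<v
    with r , refl ← gap (cancel-suc² (suc a′) v<a+b) = begin
      totalArea (suc a′) (suc (suc (j + d)) + r) c (suc a′ + j) (suc (suc a′ + j) + d) B B
        ≡⟨ same-class-shape (m+n∸m≡n (suc a′) j) (m+n∸m≡n (suc (suc a′ + j)) d) (∸-≡ end-gap) ⟩
      j * d + d * (r + c)             ≤⟨ same-class-area j d r c a′ d≤a′ c≤a ⟩
      suc (j + d + r) * a′            ≡⟨ *-comm (suc (j + d + r)) a′ ⟩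
      a′ * suc (j + d + r)            ∎
    where
    end-gap : suc (suc (suc a′ + j) + d) + (r + c) ≡ suc a′ + (suc (suc (j + d)) + r) + c
    end-gap = trans (sym (+-assoc _ r c)) (cong (_+ c) (2+[x+j]+d+r≡x+[2+j+d+r] (suc a′) j d r))
    d≤a′ : d ≤ a′
    d≤a′ = ≤-trans (≤-trans (m≤n+m d j) (≤-trans (m≤m+n (j + d) r) (n≤1+n _))) (≤-pred b≤a)

  totalArea-CC : ∀ {a b c u v} → 1 ≤ a → 1 ≤ b → c ≤ b → b ≤ a → a + b ≤ u → u < v → v < a + b + c →
    totalArea a b c u v C C ≤ (a ∸ 1) * (b ∸ 1)
  totalArea-CC 1≤a 1≤b c≤b b≤a a+b≤u u<v v<n
    with a′ , refl ← gap 1≤a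
    with b′ , refl ← gap 1≤b
    with k , refl ← gap a+b≤u
    with d , refl ← gap u<v
    with r , refl ← gap (cancel-suc² (suc a′ + suc b′) v<n) = begin
      totalArea (suc a′) (suc b′) (suc (suc (k + d)) + r) (suc a′ + suc b′ + k) (suc (suc a′ + suc b′ + k) + d) C C
        ≡⟨ same-class-shape (m+n+o∸m≡n+o (suc a′) (suc b′) k) (m+n∸m≡n (suc (suc a′ + suc b′ + k)) d)
                            (∸-≡ (2+[x+j]+d+r≡x+[2+j+d+r] (suc a′ + suc b′) k d r)) ⟩
      (suc b′ + k) * d + d * r        ≡⟨ regroup b′ k d r ⟩
      k * d + d * (r + suc b′)        ≤⟨ same-class-area k d r (suc b′) b′ d≤b′ ≤-refl ⟩
      suc (k + d + r) * b′            ≤⟨ *-monoˡ-≤ b′ 1+k+d+r≤b′ ⟩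
      b′ * b′                         ≤⟨ *-monoˡ-≤ b′ (≤-pred b≤a) ⟩
      a′ * b′                         ∎
    where
    regroup : ∀ b′ k d r → (suc b′ + k) * d + d * r ≡ k * d + d * (r + suc b′)
    regroup = solve-∀
    1+k+d+r≤b′ : suc (k + d + r) ≤ b′
    1+k+d+r≤b′ = ≤-pred c≤b
    d≤b′ : d ≤ b′
    d≤b′ = ≤-trans (m≤n+m d k) (≤-trans (m≤m+n (k + d) r) (<⇒≤ 1+k+d+r≤b′))

  totalArea-AB : ∀ {a b c u v} → a ≤ suc b → u < a → a ≤ v → v < a + b →
    totalArea a b c u v A B ≤ (a ∸ 1) * (b ∸ 1)
  totalArea-AB {c = c} {u = u} a≤1+b u<a a≤v v<a+b
    with i , refl ← gap u<a
    with j , refl ← gap a≤v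
    with j′ , refl ← gap (cancel-suc (suc u + i) v<a+b) = begin
      totalArea (suc u + i) (suc j + j′) c u (suc u + i + j) A B
        ≡⟨ A-to-B-shape u (m+n∸m≡n (suc u) i) (m+n∸m≡n (suc u + i) j)
                          (∸-≡ (suc[x+j]+k≡x+[suc-j+k] (suc u + i) j j′)) ⟩
      u * i + (i * j + u * j′)        ≤⟨ adjacent-classes-area u i j j′ (≤-pred a≤1+b) ⟩
      (u + i) * (j + j′)              ∎

  totalArea-AC : ∀ {a b c u v} → 1 ≤ b → c ≤ b → u < a → a + b ≤ v → v < a + b + c →
    totalArea a b c u v A C ≤ (a ∸ 1) * (b ∸ 1)
  totalArea-AC {a} {u = u} 1≤b c≤b u<a a+b≤v v<n
    with b′ , refl ← gap 1≤b
    with i , refl ← gap u<a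
    with k , refl ← gap a+b≤v
    with k′ , refl ← gap (cancel-suc (suc u + i + suc b′) v<n) = begin
      totalArea (suc u + i) (suc b′) (suc k + k′) u (suc u + i + suc b′ + k) A C
        ≡⟨ A-to-C-shape u (m+n∸m≡n (suc u) i) (∸-≡ (suc[x+j]+k≡x+[suc-j+k] (suc u + i + suc b′) k k′))
                        (m+n∸m≡n (suc u + i + suc b′) k) ⟩
      i * k′ + u * k                  ≤⟨ distant-classes-area u i k k′ b′ (≤-pred c≤b) ⟩
      (u + i) * b′                    ∎

  totalArea-BC : ∀ {a b c u v} → 1 ≤ a → c ≤ b → b ≤ a → a ≤ u → u < a + b → a + b ≤ v → v < a + b + c →
    totalArea a b c u v B C ≤ (a ∸ 1) * (b ∸ 1)
  totalArea-BC 1≤a c≤b b≤a a≤u u<a+b a+b≤v v<n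
    with a′ , refl ← gap 1≤a
    with j , refl ← gap a≤u
    with j′ , refl ← gap (cancel-suc (suc a′) u<a+b)
    with k , refl ← gap a+b≤v
    with k′ , refl ← gap (cancel-suc (suc a′ + (suc j + j′)) v<n) = begin
      totalArea (suc a′) (suc j + j′) (suc k + k′) (suc a′ + j) (suc a′ + (suc j + j′) + k) B C
        ≡⟨ B-to-C-shape (m+n∸m≡n (suc a′) j) (∸-≡ (suc[x+j]+k≡x+[suc-j+k] (suc a′) j j′))
                        (m+n∸m≡n (suc a′ + (suc j + j′)) k)
                        (∸-≡ (suc[x+j]+k≡x+[suc-j+k] (suc a′ + (suc j + j′)) k k′)) ⟩
      j * j′ + (j′ * k′ + (j * k + k * k′))  ≤⟨ B-to-C-area j j′ k k′ a′ (≤-pred c≤b) (≤-pred b≤a) ⟩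
      a′ * (j + j′)                   ∎

open TotalAreaBounds

record Balanced (a b c : ℕ) : Set where
  field
    1≤c   : 1 ≤ c
    c≤b   : c ≤ b
    b≤a   : b ≤ a
    a≤1+c : a ≤ suc c

module Construction (a b c : ℕ) (balanced : Balanced a b c) where
  open import Data.Bool using (true; false; not; _∧_; if_then_else_; T)
  open import Data.Bool.Properties using (T-∧)
  open import Data.Fin as Fin using (toℕ)
  import Data.Fin.Properties as Finₚ
  open import Data.Integer as ℤ using (ℤ; +_)
  import Data.Integer.Properties as ℤₚ
  open import Data.List using (length; map)
  open import Data.List.Membership.Propositional using (_∈_)
  open import Data.List.Membership.Propositional.Properties using (∈-cartesianProduct⁺; ∈-concatMap⁺)
  open import Data.List.Properties using (length-map)
  open import Data.List.Relation.Binary.Subset.Propositional using (_⊆_)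
  open import Data.List.Relation.Unary.All as All using (All)
  import Data.List.Relation.Unary.All.Properties as Allₚ
  import Data.List.Relation.Unary.Any as Any
  open import Data.List.Relation.Unary.Any.Properties using (any⁻)
  open import Data.List.Relation.Unary.Unique.Propositional using (Unique)
  import Data.List.Relation.Unary.Unique.Propositional.Properties as Uniqueₚ
  open import Data.Nat using (_+_; _*_; _∸_; _<_; _<ᵇ_; _<?_)
  open import Data.Nat.Properties
  open import Data.Nat.Tactic.RingSolver using (solve-∀)
  open import Data.Rational.Literals using (fromℤ)
  open import Data.Sign as Sign using (Sign)
  open import Function using (Equivalence)
  open import Relation.Nullary.Decidable using (dec-true; dec-false)
  open import Relation.Nullary.Reflects using (Reflects; ofʸ; ofⁿ)
  open Balanced balanced
  open Boxes a b c using (position; boxPairs; length-candidates)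

  n : ℕ
  n = a + b + c

  1≤b : 1 ≤ b
  1≤b = ≤-trans 1≤c c≤b

  1≤a : 1 ≤ a
  1≤a = ≤-trans 1≤b b≤a

  a≤n : a ≤ n
  a≤n = ≤-trans (m≤m+n a b) (m≤m+n (a + b) c)

  class : ℕ → Class
  class u = if u <ᵇ a then A else if u <ᵇ a + b then B else C

  InClass : Class → ℕ → Set
  InClass A u = u < a
  InClass B u = a ≤ u × u < a + b
  InClass C u = a + b ≤ u × u < n

  class-sound : ∀ {u} → u < n → InClass (class u) u
  class-sound {u} u<n with u <ᵇ a | <ᵇ-reflects-< u a | u <ᵇ a + b | <ᵇ-reflects-< u (a + b)
  ... | true  | ofʸ u<a | _     | _          = u<a
  ... | false | ofⁿ u≮a | true  | ofʸ u<a+b  = ≮⇒≥ u≮a , u<a+b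
  ... | false | ofⁿ _   | false | ofⁿ u≮a+b = ≮⇒≥ u≮a+b , u<n

  inClass⇒<n : ∀ {c u} → InClass c u → u < n
  inClass⇒<n {A} u<a          = <-≤-trans u<a a≤n
  inClass⇒<n {B} (_ , u<a+b)  = <-≤-trans u<a+b (m≤m+n (a + b) c)
  inClass⇒<n {C} (_ , u<n)    = u<n

  magnitude : Class → ℕ → ℕ
  magnitude A u = 3 * n ∸ u
  magnitude B u = u
  magnitude C u = 2 * n + u

  -- A-parameters lie in [-3n, -2n), B-parameters in [1, n) and C-parameters in [2n, 3n):
  -- these gaps make the sign of σ₂ on a triple of parameters depend only on their classes.
  parameterIn : Class → ℕ → ℤ
  parameterIn A u = ℤ.- + magnitude A u
  parameterIn B u = + magnitude B u
  parameterIn C u = + magnitude C u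

  parameter : ℕ → ℤ
  parameter u = parameterIn (class u) u

  point : ℕ → Point
  point u = cubicPoint (parameter u)

  -- Signs of orientations

  1≤n : 1 ≤ n
  1≤n = ≤-trans 1≤a a≤n

  n≤3n : n ≤ 3 * n
  n≤3n = m≤m+n n (2 * n)

  magnitude≤3n : ∀ {c u} → InClass c u → magnitude c u ≤ 3 * n
  magnitude≤3n {A} {u} _         = m∸n≤m (3 * n) u
  magnitude≤3n {B} u∈B           = ≤-trans (<⇒≤ (inClass⇒<n {B} u∈B)) n≤3n
  magnitude≤3n {C} {u} (_ , u<n) = subst (2 * n + u ≤_) (three n) (+-monoʳ-≤ (2 * n) (<⇒≤ u<n))
    where
    three : ∀ n → 2 * n + n ≡ 3 * n
    three = solve-∀

  2n<magnitudeA : ∀ {u} → u < n → 2 * n < magnitude A u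
  2n<magnitudeA {u} u<n = begin-strict
    2 * n               ≡⟨ +-identityʳ (2 * n) ⟨
    2 * n + 0           <⟨ +-monoʳ-< (2 * n) (m<n⇒0<n∸m u<n) ⟩
    2 * n + (n ∸ u)     ≡⟨ +-∸-assoc (2 * n) (<⇒≤ u<n) ⟨
    2 * n + n ∸ u       ≡⟨ cong (_∸ u) (three n) ⟩
    3 * n ∸ u           ∎
    where
    open ≤-Reasoning
    three : ∀ n → 2 * n + n ≡ 3 * n
    three = solve-∀

  0<magnitude : ∀ {c u} → InClass c u → 0 < magnitude c u
  0<magnitude {A} u<a       = ≤-<-trans z≤n (2n<magnitudeA (<-≤-trans u<a a≤n))
  0<magnitude {B} (a≤u , _) = ≤-trans 1≤a a≤u
  0<magnitude {C} {u} _     = ≤-trans 1≤n (≤-trans (m≤m+n n (n + 0)) (m≤m+n (2 * n) u))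

  3n<2*magnitudeA : ∀ {u} → u < n → 3 * n < 2 * magnitude A u
  3n<2*magnitudeA {u} u<n = begin-strict
    3 * n               ≤⟨ m≤m+n (3 * n) n ⟩
    3 * n + n           ≡⟨ four n ⟩
    2 * (2 * n)         <⟨ *-monoʳ-< 2 (2n<magnitudeA u<n) ⟩
    2 * magnitude A u   ∎
    where
    open ≤-Reasoning
    four : ∀ n → 3 * n + n ≡ 2 * (2 * n)
    four = solve-∀

  3n<2*magnitudeC : ∀ u → 3 * n < 2 * magnitude C u
  3n<2*magnitudeC u = begin-strict
    3 * n               <⟨ m<m+n (3 * n) 1≤n ⟩
    3 * n + n           ≡⟨ four n ⟩
    2 * (2 * n)         ≤⟨ *-monoʳ-≤ 2 (m≤m+n (2 * n) u) ⟩
    2 * magnitude C u   ∎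
    where
    open ≤-Reasoning
    four : ∀ n → 3 * n + n ≡ 2 * (2 * n)
    four = solve-∀

  private
    σ₂-no-A : ∀ c₁ c₂ c₃ {u v w} → InClass c₁ u → InClass c₂ v → InClass c₃ w →
      HasSign Sign.+ (σ₂ (+ magnitude c₁ u) (+ magnitude c₂ v) (+ magnitude c₃ w))
    σ₂-no-A c₁ c₂ c₃ {u} {v} {w} hu hv _ =
      σ₂-pos-hasSign (magnitude c₁ u) (magnitude c₂ v) (magnitude c₃ w) (0<magnitude hu) (0<magnitude hv)

    σ₂-one-A : ∀ c₂ c₃ {u v w} → InClass A u → InClass c₂ v → InClass c₃ w →
      HasSign Sign.- (σ₂ (parameterIn A u) (+ magnitude c₂ v) (+ magnitude c₃ w))
    σ₂-one-A c₂ c₃ {u} {v} {w} hu hv hw =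
      σ₂-neg-pos-pos-hasSign⁻ (magnitude A u) (magnitude c₂ v) (magnitude c₃ w) (magnitude≤3n hv) (magnitude≤3n hw)
        (3n<2*magnitudeA (inClass⇒<n {A} hu)) (<-≤-trans (0<magnitude hv) (m≤m+n _ _))

    σ₂-two-A-B : ∀ {u v w} → InClass A u → InClass A v → InClass B w →
      HasSign Sign.+ (σ₂ (parameterIn A u) (parameterIn A v) (parameterIn B w))
    σ₂-two-A-B {u} {v} {w} hu hv hw =
      σ₂-neg-neg-pos-hasSign⁺ (magnitude A u) (magnitude A v) w (2w<magnitude hu) (2w<magnitude hv)
      where
      2w<magnitude : ∀ {u} → InClass A u → 2 * w < magnitude A u
      2w<magnitude hu = <-trans (*-monoʳ-< 2 (inClass⇒<n {B} hw)) (2n<magnitudeA (inClass⇒<n {A} hu))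

    σ₂-two-A-C : ∀ {u v w} → InClass A u → InClass A v → InClass C w →
      HasSign Sign.- (σ₂ (parameterIn A u) (parameterIn A v) (parameterIn C w))
    σ₂-two-A-C {u} {v} {w} hu hv _ =
      σ₂-neg-neg-pos-hasSign⁻ (magnitude A u) (magnitude A v) (magnitude C w) (magnitude≤3n {A} hu) (magnitude≤3n {A} hv)
        (3n<2*magnitudeC w) (<-≤-trans (0<magnitude {A} hu) (m≤m+n _ _))

    σ₂-three-A : ∀ {u v w} → InClass A u → InClass A v → InClass A w →
      HasSign Sign.+ (σ₂ (parameterIn A u) (parameterIn A v) (parameterIn A w))
    σ₂-three-A {u} {v} {w} hu hv _ =
      σ₂-neg-hasSign (magnitude A u) (magnitude A v) (magnitude A w) (0<magnitude {A} hu) (0<magnitude {A} hv)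

    swap₁₂ : ∀ {s} c₁ c₂ c₃ u v w →
      HasSign s (σ₂ (parameterIn c₂ v) (parameterIn c₁ u) (parameterIn c₃ w)) →
      HasSign s (σ₂ (parameterIn c₁ u) (parameterIn c₂ v) (parameterIn c₃ w))
    swap₁₂ c₁ c₂ c₃ u v w =
      subst (HasSign _) (σ₂-comm₁₂ (parameterIn c₂ v) (parameterIn c₁ u) (parameterIn c₃ w))

    swap₂₃ : ∀ {s} c₁ c₂ c₃ u v w →
      HasSign s (σ₂ (parameterIn c₁ u) (parameterIn c₃ w) (parameterIn c₂ v)) →
      HasSign s (σ₂ (parameterIn c₁ u) (parameterIn c₂ v) (parameterIn c₃ w))
    swap₂₃ c₁ c₂ c₃ u v w =
      subst (HasSign _) (σ₂-comm₂₃ (parameterIn c₁ u) (parameterIn c₃ w) (parameterIn c₂ v))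

  σ₂-parameterIn : ∀ c₁ c₂ c₃ {u v w} → InClass c₁ u → InClass c₂ v → InClass c₃ w →
    HasSign (σ₂-sign c₁ c₂ c₃) (σ₂ (parameterIn c₁ u) (parameterIn c₂ v) (parameterIn c₃ w))
  σ₂-parameterIn A A A hu hv hw = σ₂-three-A hu hv hw
  σ₂-parameterIn A A B hu hv hw = σ₂-two-A-B hu hv hw
  σ₂-parameterIn A A C hu hv hw = σ₂-two-A-C hu hv hw
  σ₂-parameterIn A B A {u} {v} {w} hu hv hw = swap₂₃ A B A u v w (σ₂-two-A-B hu hw hv)
  σ₂-parameterIn A B B hu hv hw = σ₂-one-A B B hu hv hw
  σ₂-parameterIn A B C hu hv hw = σ₂-one-A B C hu hv hw
  σ₂-parameterIn A C A {u} {v} {w} hu hv hw = swap₂₃ A C A u v w (σ₂-two-A-C hu hw hv)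
  σ₂-parameterIn A C B hu hv hw = σ₂-one-A C B hu hv hw
  σ₂-parameterIn A C C hu hv hw = σ₂-one-A C C hu hv hw
  σ₂-parameterIn B A A {u} {v} {w} hu hv hw = swap₁₂ B A A u v w (swap₂₃ A B A v u w (σ₂-two-A-B hv hw hu))
  σ₂-parameterIn B A B {u} {v} {w} hu hv hw = swap₁₂ B A B u v w (σ₂-one-A B B hv hu hw)
  σ₂-parameterIn B A C {u} {v} {w} hu hv hw = swap₁₂ B A C u v w (σ₂-one-A B C hv hu hw)
  σ₂-parameterIn B B A {u} {v} {w} hu hv hw = swap₂₃ B B A u v w (swap₁₂ B A B u w v (σ₂-one-A B B hw hu hv))
  σ₂-parameterIn B B B hu hv hw = σ₂-no-A B B B hu hv hw
  σ₂-parameterIn B B C hu hv hw = σ₂-no-A B B C hu hv hw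
  σ₂-parameterIn B C A {u} {v} {w} hu hv hw = swap₂₃ B C A u v w (swap₁₂ B A C u w v (σ₂-one-A B C hw hu hv))
  σ₂-parameterIn B C B hu hv hw = σ₂-no-A B C B hu hv hw
  σ₂-parameterIn B C C hu hv hw = σ₂-no-A B C C hu hv hw
  σ₂-parameterIn C A A {u} {v} {w} hu hv hw = swap₁₂ C A A u v w (swap₂₃ A C A v u w (σ₂-two-A-C hv hw hu))
  σ₂-parameterIn C A B {u} {v} {w} hu hv hw = swap₁₂ C A B u v w (σ₂-one-A C B hv hu hw)
  σ₂-parameterIn C A C {u} {v} {w} hu hv hw = swap₁₂ C A C u v w (σ₂-one-A C C hv hu hw)
  σ₂-parameterIn C B A {u} {v} {w} hu hv hw = swap₂₃ C B A u v w (swap₁₂ C A B u w v (σ₂-one-A C B hw hu hv))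
  σ₂-parameterIn C B B hu hv hw = σ₂-no-A C B B hu hv hw
  σ₂-parameterIn C B C hu hv hw = σ₂-no-A C B C hu hv hw
  σ₂-parameterIn C C A {u} {v} {w} hu hv hw = swap₂₃ C C A u v w (swap₁₂ C A C u w v (σ₂-one-A C C hw hu hv))
  σ₂-parameterIn C C B hu hv hw = σ₂-no-A C C B hu hv hw
  σ₂-parameterIn C C C hu hv hw = σ₂-no-A C C C hu hv hw

  parameterIn-mono : ∀ {c d u v} → InClass c u → InClass d v → u < v → parameterIn c u ℤ.< parameterIn d v
  parameterIn-mono {A} {A} _ v∈A u<v =
    ℤₚ.neg-mono-< (ℤ.+<+ (∸-monoʳ-< u<v (≤-trans (<⇒≤ (inClass⇒<n {A} v∈A)) n≤3n)))
  parameterIn-mono {A} {B} _ v∈B _ = ℤₚ.≤-<-trans ℤₚ.neg-≤-pos (ℤ.+<+ (0<magnitude {B} v∈B))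
  parameterIn-mono {A} {C} _ v∈C _ = ℤₚ.≤-<-trans ℤₚ.neg-≤-pos (ℤ.+<+ (0<magnitude {C} v∈C))
  parameterIn-mono {B} {A} (a≤u , _) v<a u<v = ⊥-elim (<-asym (<-≤-trans v<a a≤u) u<v)
  parameterIn-mono {B} {B} _ _ u<v = ℤ.+<+ u<v
  parameterIn-mono {B} {C} {v = v} _ _ u<v = ℤ.+<+ (<-≤-trans u<v (m≤n+m v (2 * n)))
  parameterIn-mono {C} {A} (a+b≤u , _) v<a u<v = ⊥-elim (<-asym (<-≤-trans v<a (≤-trans (m≤m+n a b) a+b≤u)) u<v)
  parameterIn-mono {C} {B} (a+b≤u , _) (_ , v<a+b) u<v = ⊥-elim (<-asym (<-≤-trans v<a+b a+b≤u) u<v)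
  parameterIn-mono {C} {C} _ _ u<v = ℤ.+<+ (+-monoʳ-< (2 * n) u<v)

  parameter-mono : ∀ {u v} → u < v → v < n → parameter u ℤ.< parameter v
  parameter-mono u<v v<n = parameterIn-mono (class-sound (<-trans u<v v<n)) (class-sound v<n) u<v

  <ᵇ-true : ∀ {u v} → u < v → (u <ᵇ v) ≡ true
  <ᵇ-true {u} {v} u<v = dec-true (u <? v) u<v

  <ᵇ-false : ∀ {u v} → v ≤ u → (u <ᵇ v) ≡ false
  <ᵇ-false {u} {v} v≤u = dec-false (u <? v) (≤⇒≯ v≤u)

  parameter-difference-sign : ∀ {u v} → u < n → v < n → u ≢ v →
    HasSign (orderSign (u <ᵇ v)) (parameter v ℤ.- parameter u)
  parameter-difference-sign {u} {v} u<n v<n u≢v with <-cmp u v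
  ... | tri< u<v _ _ rewrite <ᵇ-true u<v = <⇒hasSign⁺ (parameter-mono u<v v<n)
  ... | tri≈ _ u≡v _ = ⊥-elim (u≢v u≡v)
  ... | tri> _ _ v<u rewrite <ᵇ-false (<⇒≤ v<u) = >⇒hasSign⁻ (parameter-mono v<u u<n)

  orientationSign : ℕ → ℕ → ℕ → Sign
  orientationSign u v w = orderSign (u <ᵇ v) Sign.* sideSign (u <ᵇ w) (v <ᵇ w) (class u) (class v) (class w)

  orientation-point : ∀ u v w → orientation (point u) (point v) (point w) ≡
    fromℤ ((parameter v ℤ.- parameter u) ℤ.* ((parameter w ℤ.- parameter u) ℤ.* (parameter w ℤ.- parameter v) ℤ.*
           σ₂ (parameter u) (parameter v) (parameter w)))
  orientation-point u v w = orientation-cubicPoint (parameter u) (parameter v) (parameter w)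

  orientation-hasSign : ∀ {u v w} → u < n → v < n → w < n → u ≢ v → u ≢ w → v ≢ w →
    HasSign (orientationSign u v w)
      ((parameter v ℤ.- parameter u) ℤ.* ((parameter w ℤ.- parameter u) ℤ.* (parameter w ℤ.- parameter v) ℤ.*
       σ₂ (parameter u) (parameter v) (parameter w)))
  orientation-hasSign {u} {v} {w} u<n v<n w<n u≢v u≢w v≢w =
    *-hasSign (parameter-difference-sign u<n v<n u≢v)
      (*-hasSign (*-hasSign (parameter-difference-sign u<n w<n u≢w) (parameter-difference-sign v<n w<n v≢w))
                 (σ₂-parameterIn (class u) (class v) (class w) (class-sound u<n) (class-sound v<n) (class-sound w<n)))

  point-noncollinear : ∀ {u v w} → u < n → v < n → w < n → u ≢ v → u ≢ w → v ≢ w →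
    ¬ Collinear (point u) (point v) (point w)
  point-noncollinear {u} {v} {w} u<n v<n w<n u≢v u≢w v≢w collinear =
    hasSign⇒fromℤ≢0 (orientation-hasSign u<n v<n w<n u≢v u≢w v≢w) (trans (sym (orientation-point u v w)) collinear)

  separates⇒orientationSign≢ : ∀ {u v x y} → u < n → v < n → x < n → y < n →
    u ≢ v → u ≢ x → u ≢ y → v ≢ x → v ≢ y →
    Separates (point u) (point v) (point x) (point y) → orientationSign u v x ≢ orientationSign u v y
  separates⇒orientationSign≢ {u} {v} {x} {y} u<n v<n x<n y<n u≢v u≢x u≢y v≢x v≢y separates same =
    separates (subst₂ SameSign (sym (orientation-point u v x)) (sym (orientation-point u v y))
      (sameSign-fromℤ (subst (λ s → HasSign s _) same (orientation-hasSign u<n v<n x<n u≢v u≢x v≢x))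
                      (orientation-hasSign u<n v<n y<n u≢v u≢y v≢y)))

  3≤n : 3 ≤ n
  3≤n = +-mono-≤ (+-mono-≤ (≤-trans 1≤c (≤-trans c≤b b≤a)) (≤-trans 1≤c c≤b)) 1≤c

  drawing : Fin n → Point
  drawing i = point (toℕ i)

  drawing-generalPosition : GeneralPosition drawing
  drawing-generalPosition = noncollinear⇒injective 3≤n noncollinear , noncollinear
    where
    noncollinear : ∀ i j k → i ≢ j → j ≢ k → i ≢ k → ¬ Collinear (drawing i) (drawing j) (drawing k)
    noncollinear i j k i≢j j≢k i≢k = point-noncollinear (Finₚ.toℕ<n i) (Finₚ.toℕ<n j) (Finₚ.toℕ<n k)
      (i≢j ∘ Finₚ.toℕ-injective) (i≢k ∘ Finₚ.toℕ-injective) (j≢k ∘ Finₚ.toℕ-injective)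

  -- Crossing pairs and the candidate boxes

  patternOf : ℕ → ℕ → ℕ → ℕ → Pattern
  patternOf u v x y = mkPattern (u <ᵇ x) (u <ᵇ y) (v <ᵇ x) (v <ᵇ y) (class u) (class v) (class x) (class y)

  private
    ∧-intro : ∀ {p q} → T p → T q → T (p ∧ q)
    ∧-intro tp tq = Equivalence.from T-∧ (tp , tq)

    ∧-elim : ∀ p {q} → T (p ∧ q) → T p × T q
    ∧-elim p = Equivalence.to (T-∧ {p})

  <ᵇ-flip : ∀ {u x} → x ≢ u → (x <ᵇ u) ≡ not (u <ᵇ x)
  <ᵇ-flip {u} {x} x≢u with <-cmp u x
  ... | tri< u<x _ _ rewrite <ᵇ-true u<x | <ᵇ-false (<⇒≤ u<x) = refl
  ... | tri≈ _ u≡x _ = ⊥-elim (x≢u (sym u≡x))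
  ... | tri> _ _ x<u rewrite <ᵇ-true x<u | <ᵇ-false (<⇒≤ x<u) = refl

  class-mono : ∀ {u v} → u ≤ v → v < n → T (class u ≤ᶜ class v)
  class-mono {u} {v} u≤v v<n = go (class u) (class v) (class-sound (≤-<-trans u≤v v<n)) (class-sound v<n)
    where
    go : ∀ cu cv → InClass cu u → InClass cv v → T (cu ≤ᶜ cv)
    go A _ _ _ = _
    go B A (a≤u , _) v<a = ⊥-elim (<⇒≱ v<a (≤-trans a≤u u≤v))
    go B B _ _ = _
    go B C _ _ = _
    go C A (a+b≤u , _) v<a = ⊥-elim (<⇒≱ v<a (≤-trans (m≤m+n a b) (≤-trans a+b≤u u≤v)))
    go C B (a+b≤u , _) (_ , v<a+b) = ⊥-elim (<⇒≱ v<a+b (≤-trans a+b≤u u≤v))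
    go C C _ _ = _

  ⇒ᵇ-<ᵇˡ : ∀ {u v} x → u ≤ v → T ((v <ᵇ x) ⇒ᵇ (u <ᵇ x))
  ⇒ᵇ-<ᵇˡ {u} {v} x u≤v with v <ᵇ x | <ᵇ-reflects-< v x
  ... | true  | ofʸ v<x = <⇒<ᵇ (≤-<-trans u≤v v<x)
  ... | false | _       = _

  ⇒ᵇ-<ᵇʳ : ∀ u {x y} → x ≤ y → T ((u <ᵇ x) ⇒ᵇ (u <ᵇ y))
  ⇒ᵇ-<ᵇʳ u {x} x≤y with u <ᵇ x | <ᵇ-reflects-< u x
  ... | true  | ofʸ u<x = <⇒<ᵇ (<-≤-trans u<x x≤y)
  ... | false | _       = _

  ordered-class : ∀ {u x} → u < n → x < n → T (ordered (u <ᵇ x) (class u) (class x))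
  ordered-class {u} {x} u<n x<n with u <ᵇ x | <ᵇ-reflects-< u x
  ... | true  | ofʸ u<x = class-mono (<⇒≤ u<x) x<n
  ... | false | ofⁿ u≮x = class-mono (≮⇒≥ u≮x) u<n

  realisable-patternOf : ∀ {u v x y} → u < v → x < y → v < n → y < n → T (realisable (patternOf u v x y))
  realisable-patternOf {u} {v} {x} {y} u<v x<y v<n y<n =
    ∧-intro (⇒ᵇ-<ᵇˡ x (<⇒≤ u<v)) (∧-intro (⇒ᵇ-<ᵇˡ y (<⇒≤ u<v)) (∧-intro (⇒ᵇ-<ᵇʳ u (<⇒≤ x<y))
      (∧-intro (⇒ᵇ-<ᵇʳ v (<⇒≤ x<y)) (∧-intro (class-mono (<⇒≤ u<v) v<n) (∧-intro (class-mono (<⇒≤ x<y) y<n)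
      (∧-intro (ordered-class u<n x<n) (∧-intro (ordered-class u<n y<n)
      (∧-intro (ordered-class v<n x<n) (ordered-class v<n y<n)))))))))
    where
    u<n = <-trans u<v v<n
    x<n = <-trans x<y y<n

  orientationSign-ordered : ∀ {u v} w → u < v →
    orientationSign u v w ≡ sideSign (u <ᵇ w) (v <ᵇ w) (class u) (class v) (class w)
  orientationSign-ordered {u} {v} w u<v =
    cong (λ b → orderSign b Sign.* sideSign (u <ᵇ w) (v <ᵇ w) (class u) (class v) (class w)) (<ᵇ-true u<v)

  ≢⇒≠ˢ : ∀ {s t} → s ≢ t → T (s ≠ˢ t)
  ≢⇒≠ˢ {Sign.+} {Sign.+} s≢t = s≢t refl
  ≢⇒≠ˢ {Sign.+} {Sign.-} _   = _
  ≢⇒≠ˢ {Sign.-} {Sign.+} _   = _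
  ≢⇒≠ˢ {Sign.-} {Sign.-} s≢t = s≢t refl

  orientationSign-reversed : ∀ {x y w} → x < y → w ≢ x → w ≢ y →
    orientationSign x y w ≡ sideSign (not (w <ᵇ x)) (not (w <ᵇ y)) (class x) (class y) (class w)
  orientationSign-reversed {x} {y} {w} x<y w≢x w≢y = trans (orientationSign-ordered w x<y)
    (cong₂ (λ p q → sideSign p q (class x) (class y) (class w)) (<ᵇ-flip (≢-sym w≢x)) (<ᵇ-flip (≢-sym w≢y)))

  crossing-patternOf : ∀ {u v x y} → u < v → x < y → v < n → y < n → u ≢ x → u ≢ y → v ≢ x → v ≢ y →
    Separates (point u) (point v) (point x) (point y) → Separates (point x) (point y) (point u) (point v) →
    T (crossing (patternOf u v x y))
  crossing-patternOf {u} {v} {x} {y} u<v x<y v<n y<n u≢x u≢y v≢x v≢y uv-separates xy-separates =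
    ∧-intro (≢⇒≠ˢ (subst₂ _≢_ (orientationSign-ordered x u<v) (orientationSign-ordered y u<v) uv-differ))
            (≢⇒≠ˢ (subst₂ _≢_ (orientationSign-reversed x<y u≢x u≢y) (orientationSign-reversed x<y v≢x v≢y) xy-differ))
    where
    u<n = <-trans u<v v<n
    x<n = <-trans x<y y<n
    uv-differ = separates⇒orientationSign≢ u<n v<n x<n y<n (<⇒≢ u<v) u≢x u≢y v≢x v≢y uv-separates
    xy-differ = separates⇒orientationSign≢ x<n y<n u<n v<n (<⇒≢ x<y)
                  (≢-sym u≢x) (≢-sym v≢x) (≢-sym u≢y) (≢-sym v≢y) xy-separates

  landmark≤-reflects : ∀ {u v x} L → x < n → x ≢ u → x ≢ v →
    Reflects (position u v L ≤ x) (landmark≤ L (u <ᵇ x) (v <ᵇ x) (class x))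
  landmark≤-reflects start _ _ _ = ofʸ z≤n
  landmark≤-reflects {x = x} startB x<n _ _ with class x | class-sound x<n
  ... | A | x<a         = ofⁿ (<⇒≱ x<a)
  ... | B | (a≤x , _)   = ofʸ a≤x
  ... | C | (a+b≤x , _) = ofʸ (≤-trans (m≤m+n a b) a+b≤x)
  landmark≤-reflects {x = x} startC x<n _ _ with class x | class-sound x<n
  ... | A | x<a         = ofⁿ (<⇒≱ (<-≤-trans x<a (m≤m+n a b)))
  ... | B | (_ , x<a+b) = ofⁿ (<⇒≱ x<a+b)
  ... | C | (a+b≤x , _) = ofʸ a+b≤x
  landmark≤-reflects end x<n _ _ = ofⁿ (<⇒≱ x<n)
  landmark≤-reflects {u} {x = x} atU _ x≢u _ with u <ᵇ x | <ᵇ-reflects-< u x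
  ... | true  | ofʸ u<x = ofʸ (<⇒≤ u<x)
  ... | false | ofⁿ u≮x = ofⁿ (λ u≤x → u≮x (≤∧≢⇒< u≤x (≢-sym x≢u)))
  landmark≤-reflects {u} {x = x} afterU _ _ _ = <ᵇ-reflects-< u x
  landmark≤-reflects {v = v} {x} atV _ _ x≢v with v <ᵇ x | <ᵇ-reflects-< v x
  ... | true  | ofʸ v<x = ofʸ (<⇒≤ v<x)
  ... | false | ofⁿ v≮x = ofⁿ (λ v≤x → v≮x (≤∧≢⇒< v≤x (≢-sym x≢v)))
  landmark≤-reflects {v = v} {x} afterV _ _ _ = <ᵇ-reflects-< v x

  private
    reflects-T : ∀ {P : Set} {p} → Reflects P p → T p → P
    reflects-T (ofʸ holds) _ = holds

    reflects-T-not : ∀ {P : Set} {p} → Reflects P p → T (not p) → ¬ P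
    reflects-T-not (ofⁿ fails) _ = fails

  inRange-sound : ∀ {u v x} from to → x < n → x ≢ u → x ≢ v →
    T (inRange from to (u <ᵇ x) (v <ᵇ x) (class x)) → x ∈ range (position u v from) (position u v to)
  inRange-sound {u} {v} {x} from to x<n x≢u x≢v x-in-range = ∈-range
    (reflects-T (landmark≤-reflects from x<n x≢u x≢v) (proj₁ bounds))
    (≰⇒> (reflects-T-not (landmark≤-reflects to x<n x≢u x≢v) (proj₂ bounds)))
    where
    bounds = ∧-elim (landmark≤ from (u <ᵇ x) (v <ᵇ x) (class x)) x-in-range

  inBox-sound : ∀ {u v x y} X → x < n → y < n → x ≢ u → x ≢ v → y ≢ u → y ≢ v →
    T (inBox (patternOf u v x y) X) → (x , y) ∈ boxPairs u v X
  inBox-sound {u} {v} {x} (box x₀ x₁ y₀ y₁) x<n y<n x≢u x≢v y≢u y≢v in-box =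
    ∈-cartesianProduct⁺ (inRange-sound x₀ x₁ x<n x≢u x≢v (proj₁ ranges))
                        (inRange-sound y₀ y₁ y<n y≢u y≢v (proj₂ ranges))
    where
    ranges = ∧-elim (inRange x₀ x₁ (u <ᵇ x) (v <ᵇ x) (class x)) in-box

  covered⇒candidate : ∀ {u v x y} → x < n → y < n → x ≢ u → x ≢ v → y ≢ u → y ≢ v →
    T (covered (patternOf u v x y)) → (x , y) ∈ candidates a b c u v (class u) (class v)
  covered⇒candidate {u} {v} {x} {y} x<n y<n x≢u x≢v y≢u y≢v is-covered =
    ∈-concatMap⁺ (boxPairs u v)
      (Any.map (λ {X} → inBox-sound X x<n y<n x≢u x≢v y≢u y≢v)
               (any⁻ (inBox (patternOf u v x y)) (boxes (class u) (class v)) is-covered))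

  -- Counting crossings

  totalArea-bound : ∀ {u v} → u < v → v < n → totalArea a b c u v (class u) (class v) ≤ (a ∸ 1) * (b ∸ 1)
  totalArea-bound {u} {v} u<v v<n = go (class u) (class v) (class-sound (<-trans u<v v<n)) (class-sound v<n)
    where
    c≤a = ≤-trans c≤b b≤a
    a≤1+b = ≤-trans a≤1+c (s≤s c≤b)
    go : ∀ cu cv → InClass cu u → InClass cv v → totalArea a b c u v cu cv ≤ (a ∸ 1) * (b ∸ 1)
    go A A _               v<a             = totalArea-AA {c = c} a≤1+b u<v v<a
    go A B u<a             (a≤v , v<a+b)   = totalArea-AB {c = c} a≤1+b u<a a≤v v<a+b
    go A C u<a             (a+b≤v , v<n)   = totalArea-AC 1≤b c≤b u<a a+b≤v v<n
    go B B (a≤u , _)       (_ , v<a+b)     = totalArea-BB 1≤a c≤a b≤a a≤u u<v v<a+b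
    go B C (a≤u , u<a+b)   (a+b≤v , v<n)   = totalArea-BC 1≤a c≤b b≤a a≤u u<a+b a+b≤v v<n
    go C C (a+b≤u , _)     (_ , v<n)       = totalArea-CC 1≤a 1≤b c≤b b≤a a+b≤u u<v v<n
    go B A _ _ = z≤n
    go C A _ _ = z≤n
    go C B _ _ = z≤n

  crossing⇒candidate : ∀ {i j k l} → i Fin.< j → k Fin.< l → Crosses drawing (i , j) (k , l) →
    (toℕ k , toℕ l) ∈ candidates a b c (toℕ i) (toℕ j) (class (toℕ i)) (class (toℕ j))
  crossing⇒candidate {i} {j} {k} {l} i<j k<l crosses =
    candidate (crossing⇒separates drawing-generalPosition i<j k<l crosses)
    where
    j<n = Finₚ.toℕ<n j
    k<n = Finₚ.toℕ<n k
    l<n = Finₚ.toℕ<n l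
    toℕ-≢ : ∀ {i j : Fin n} → i ≢ j → toℕ i ≢ toℕ j
    toℕ-≢ i≢j = i≢j ∘ Finₚ.toℕ-injective
    candidate : (i ≢ k × i ≢ l × j ≢ k × j ≢ l) × Separates (drawing i) (drawing j) (drawing k) (drawing l)
                                               × Separates (drawing k) (drawing l) (drawing i) (drawing j) →
      (toℕ k , toℕ l) ∈ candidates a b c (toℕ i) (toℕ j) (class (toℕ i)) (class (toℕ j))
    candidate ((i≢k , i≢l , j≢k , j≢l) , ij-separates , kl-separates) =
      covered⇒candidate k<n l<n (≢-sym (toℕ-≢ i≢k)) (≢-sym (toℕ-≢ j≢k)) (≢-sym (toℕ-≢ i≢l)) (≢-sym (toℕ-≢ j≢l))
        (crossing-patterns-covered (patternOf (toℕ i) (toℕ j) (toℕ k) (toℕ l))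
          (realisable-patternOf i<j k<l j<n l<n)
          (crossing-patternOf i<j k<l j<n l<n (toℕ-≢ i≢k) (toℕ-≢ i≢l) (toℕ-≢ j≢k) (toℕ-≢ j≢l)
                              ij-separates kl-separates))

  crossing-edges-bound : ∀ e → Edge e → ∀ es → Unique es → All (λ f → Edge f × Crosses drawing e f) es →
    length es ≤ (a ∸ 1) * (b ∸ 1)
  crossing-edges-bound (i , j) i<j es unique-es crossing-es = begin
    length es                   ≡⟨ length-map toℕ² es ⟨
    length (map toℕ² es)        ≤⟨ unique-⊆⇒length≤ (Uniqueₚ.map⁺ toℕ²-injective unique-es) map-es⊆candidates ⟩
    length (candidates a b c (toℕ i) (toℕ j) (class (toℕ i)) (class (toℕ j)))
                                ≡⟨ length-candidates (toℕ i) (toℕ j) (class (toℕ i)) (class (toℕ j)) ⟩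
    totalArea a b c (toℕ i) (toℕ j) (class (toℕ i)) (class (toℕ j))
                                ≤⟨ totalArea-bound i<j (Finₚ.toℕ<n j) ⟩
    (a ∸ 1) * (b ∸ 1)           ∎
    where
    open ≤-Reasoning
    toℕ² : Fin n × Fin n → ℕ × ℕ
    toℕ² (k , l) = toℕ k , toℕ l
    toℕ²-injective : ∀ {e f} → toℕ² e ≡ toℕ² f → e ≡ f
    toℕ²-injective {_ , _} {_ , _} eq =
      cong₂ _,_ (Finₚ.toℕ-injective (cong proj₁ eq)) (Finₚ.toℕ-injective (cong proj₂ eq))
    map-es⊆candidates : map toℕ² es ⊆ candidates a b c (toℕ i) (toℕ j) (class (toℕ i)) (class (toℕ j))
    map-es⊆candidates =
      All.lookup (Allₚ.map⁺ (All.map (λ (k<l , crosses) → crossing⇒candidate i<j k<l crosses) crossing-es))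

  drawing-localCrossings : LcrTimes9AtMost drawing (9 * ((a ∸ 1) * (b ∸ 1)))
  drawing-localCrossings e e-edge es unique-es crossing-es =
    *-monoʳ-≤ 9 (crossing-edges-bound e e-edge es unique-es crossing-es)

module Partitions where
  open import Data.Nat using (_+_; _*_; _∸_; _<_)
  open import Data.Nat.Properties using (≤-refl; n≤1+n; <⇒≱; +-identityʳ)
  open import Data.Nat.DivMod using (_%_; _/_; m≡m%n+[m/n]*n; m%n<n; [m+kn]%n≡m%n)
  open import Data.Nat.Tactic.RingSolver using (solve-∀)

  record BalancedPartition (n : ℕ) : Set where
    field
      a b c    : ℕ
      sum      : a + b + c ≡ n
      balanced : Balanced a b c
      bound    : 9 * ((a ∸ 1) * (b ∸ 1)) ≡ boundNumer n

  private
    boundNumer-mod0 : ∀ n → n % 3 ≡ 0 → boundNumer n ≡ (n ∸ 3) * (n ∸ 3)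
    boundNumer-mod0 n n%3≡0 rewrite n%3≡0 = refl

    boundNumer-mod1 : ∀ n → n % 3 ≡ 1 → boundNumer n ≡ (n ∸ 1) * (n ∸ 4)
    boundNumer-mod1 n n%3≡1 rewrite n%3≡1 = refl

    boundNumer-mod2 : ∀ n → n % 3 ≡ 2 → boundNumer n ≡ (n ∸ 2) * (n ∸ 2)
    boundNumer-mod2 n n%3≡2 rewrite n%3≡2 = refl

  partition-by-residue : ∀ r m → r < 3 → BalancedPartition (r + suc m * 3)
  partition-by-residue 0 m _ = record
    { a = suc m ; b = suc m ; c = suc m
    ; sum      = sum m
    ; balanced = record { 1≤c = s≤s z≤n ; c≤b = ≤-refl ; b≤a = ≤-refl ; a≤1+c = n≤1+n (suc m) }
    ; bound    = trans (bound m) (sym (boundNumer-mod0 (0 + suc m * 3) ([m+kn]%n≡m%n 0 (suc m) 3)))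
    }
    where
    sum : ∀ m → suc m + suc m + suc m ≡ 0 + suc m * 3
    sum = solve-∀
    bound : ∀ m → 9 * (m * m) ≡ (m * 3) * (m * 3)
    bound = solve-∀
  partition-by-residue 1 m _ = record
    { a = suc (suc m) ; b = suc m ; c = suc m
    ; sum      = sum m
    ; balanced = record { 1≤c = s≤s z≤n ; c≤b = ≤-refl ; b≤a = n≤1+n (suc m) ; a≤1+c = ≤-refl }
    ; bound    = trans (bound m) (sym (boundNumer-mod1 (1 + suc m * 3) ([m+kn]%n≡m%n 1 (suc m) 3)))
    }
    where
    sum : ∀ m → suc (suc m) + suc m + suc m ≡ 1 + suc m * 3
    sum = solve-∀
    bound : ∀ m → 9 * (suc m * m) ≡ (suc m * 3) * (m * 3)
    bound = solve-∀
  partition-by-residue 2 m _ = record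
    { a = suc (suc m) ; b = suc (suc m) ; c = suc m
    ; sum      = sum m
    ; balanced = record { 1≤c = s≤s z≤n ; c≤b = n≤1+n (suc m) ; b≤a = ≤-refl ; a≤1+c = ≤-refl }
    ; bound    = trans (bound m) (sym (boundNumer-mod2 (2 + suc m * 3) ([m+kn]%n≡m%n 2 (suc m) 3)))
    }
    where
    sum : ∀ m → suc (suc m) + suc (suc m) + suc m ≡ 2 + suc m * 3
    sum = solve-∀
    bound : ∀ m → 9 * (suc m * suc m) ≡ (suc m * 3) * (suc m * 3)
    bound = solve-∀
  partition-by-residue (suc (suc (suc _))) _ (s≤s (s≤s (s≤s ())))

  balanced-partition : ∀ n → 3 ≤ n → BalancedPartition n
  balanced-partition n 3≤n = split (n / 3) (m≡m%n+[m/n]*n n 3)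
    where
    split : ∀ q → n ≡ n % 3 + q * 3 → BalancedPartition n
    split zero    n≡n%3+0 =
      ⊥-elim (<⇒≱ (subst (_< 3) (trans (sym (+-identityʳ (n % 3))) (sym n≡n%3+0)) (m%n<n n 3)) 3≤n)
    split (suc m) n≡r+q*3 = subst BalancedPartition (sym n≡r+q*3) (partition-by-residue (n % 3) m (m%n<n n 3))

open Partitions

theorem4 : (n : ℕ) → 3 ≤ n →
    Σ (Fin n → Point) (λ p → GeneralPosition p × LcrTimes9AtMost p (boundNumer n))
theorem4 n 3≤n with balanced-partition n 3≤n
... | record { a = a ; b = b ; c = c ; sum = refl ; balanced = balanced ; bound = bound } =
  drawing , drawing-generalPosition , subst (LcrTimes9AtMost drawing) bound drawing-localCrossings
  where open Construction a b c balanced using (drawing; drawing-generalPosition; drawing-localCrossings)
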